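{- Let $k$ be an even positive integer, let $1\leq\ell_1\leq\ell_2\leq\ell_3\leq\ell_4$ be integers and $n=\ell_1+\ell_2+\ell_3+\ell_4$. Then the spider graph $S_{\ell_1,\ell_2,\ell_3,\ell_4}$ can be embedded in $K_k^*$ if and only if $k\geq4$, $n\leq\frac{k^2+4}{2}$, and $(k,\ell_1)\neq(4,2)$.
   Context: $K_k^*$ denotes the complete graph $K_k$ on vertices $v_0,\dotsc,v_{k-1}$ with a loop $v_iv_i$ added at every vertex. An embedding of a graph $G$ in $K_k^*$ is a map $f:V(G)\to V(K_k^*)$ such that each edge $uv$ of $G$ is sent to the edge $f(u)f(v)$ of $K_k^*$ (a loop if $f(u)=f(v)$), and the induced map $E(G)\to E(K_k^*)$ is injective. The spider graph $S_{\ell_1,\ell_2,\ell_3,\ell_4}$ is the tree with central vertex $x_0$ and four paths (legs) $x_0x^i_1\dotsb x^i_{\ell_i}$, $i=1,\dotsc,4$, of $\ell_i$ edges each, sharing only $x_0$. -}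

module Defs where

open import Data.Nat using (ℕ; zero; suc)
open import Data.Fin using (Fin; zero; suc; inject₁)
open import Data.Product using (_×_; Σ; _,_; proj₁; proj₂)
open import Data.Sum using (_⊎_)
open import Relation.Binary.PropositionalEquality using (_≡_)

record Graph : Set₁ where
  field
    V   : Set
    E   : Set
    end : E → V × V   -- the two endpoints of an edge (unordered; order irrelevant)

open Graph public

-- Equality of unordered pairs {a,b} = {c,d}; such pairs (with a = b allowed)
-- are exactly the edges of K_k^* (complete graph with a loop at every vertex).
SamePair : {A : Set} → A × A → A × A → Set
SamePair (a , b) (c , d) = (a ≡ c × b ≡ d) ⊎ (a ≡ d × b ≡ c)

imageEdge : (G : Graph) {k : ℕ} → (V G → Fin k) → E G → Fin k × Fin k
imageEdge G f e = f (proj₁ (end G e)) , f (proj₂ (end G e))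

-- An embedding of G in K_k^* (vertices v_0..v_{k-1} = Fin k): a vertex map
-- such that the induced map E(G) → E(K_k^*) is injective.
EmbedsIn : Graph → ℕ → Set
EmbedsIn G k =
  Σ (V G → Fin k) λ f →
    (e e' : E G) → SamePair (imageEdge G f e) (imageEdge G f e') → e ≡ e'

-- Spider S_{ℓ 0, ℓ 1, ℓ 2, ℓ 3}: centre x₀ and four legs;
-- leg i j  (j : Fin (ℓ i)) stands for the vertex x^i_{j+1}.
data SpiderV (ℓ : Fin 4 → ℕ) : Set where
  centre : SpiderV ℓ
  leg    : (i : Fin 4) → Fin (ℓ i) → SpiderV ℓ

-- Edge number j of leg i (j : Fin (ℓ i)) joins x^i_j and x^i_{j+1}
-- (with x^i_0 = x₀).
data SpiderE (ℓ : Fin 4 → ℕ) : Set where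
  legE : (i : Fin 4) → Fin (ℓ i) → SpiderE ℓ

prevOn : {A : Set} {m : ℕ} → A → (Fin m → A) → Fin m → A
prevOn c g zero    = c
prevOn c g (suc j) = g (inject₁ j)

spiderEnd : (ℓ : Fin 4 → ℕ) → SpiderE ℓ → SpiderV ℓ × SpiderV ℓ
spiderEnd ℓ (legE i j) = prevOn centre (leg i) j , leg i j

Spider : (Fin 4 → ℕ) → Graph
Spider ℓ = record { V = SpiderV ℓ ; E = SpiderE ℓ ; end = spiderEnd ℓ }

{-# OPTIONS --safe #-}
module Submission where

-- Necessity.  A vertex of K_k* has degree k + 1, counting the loop twice, and the degree of v in the image of the
-- spider has the parity of the number of legs that end at v.  As k + 1 is odd, the degree of v is at most k plus that
-- number; summing over v gives 2 n ≤ k² + 4.  The first vertices of the legs are distinct, so k ≥ 4, and if k = 4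
-- then some leg starts with the loop at the image of x₀ and cannot be continued.
--
-- Sufficiency.  A leg may be shortened, so let 2 n = k² + 4.  Passing from k to k + 2 adds two looped vertices u, v
-- and all their edges to the old vertices; leaving out uv, these are the 2 k + 2 edges needed.  If x and y are the
-- first vertices of two legs, the new edges decompose into a closed trail through x of length 4 p and a closed trail
-- through y of length 4 (q + 1) + 2 that uses both loops, where p + q + 1 = k / 2.  Inserting them lengthens the two
-- legs, and every admissible quadruple of lengths arises in this way from a smaller one, except for k = 4 and for
-- k = 6 with all legs of length at least 2; these are settled by explicit tables.

open import Defs
open import Data.Nat
  using (ℕ; zero; suc; _+_; _*_; _∸_; _⊓_; _≤_; _<_; _≥_; _≟_; _≤?_; _<?_; z≤n; s≤s; s≤s⁻¹)
open import Data.Nat.Properties hiding (_≟_; _≤?_; _<?_)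
open import Data.Nat.Divisibility using (_∣_; divides)
open import Data.Nat.DivMod using (_/_; _%_; m≡m%n+[m/n]*n; m%n<n)
open import Data.Nat.ListAction using () renaming (sum to sumˡ)
open import Data.Nat.ListAction.Properties using (sum-↭)
open import Data.Nat.Tactic.RingSolver using (solve-∀)
open import Data.Fin using (Fin; zero; suc; toℕ; fromℕ; fromℕ<; inject₁; inject≤)
open import Data.Fin.Patterns using (0F; 1F; 2F; 3F; 4F; 5F)
import Data.Fin.Properties as Fin
open import Data.Fin.Properties
  using (toℕ-inject≤; toℕ-inject₁; toℕ-injective; injective⇒≤; pigeonhole)
open import Data.List
  using (List; []; _∷_; [_]; _++_; length; lookup; map; concatMap; allFin; take; drop)
open import Data.List.Properties
  using (length-map; map-++; concatMap-++; take++drop≡id; length-take; length-drop; length-tabulate; ≡-dec)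
open import Data.List.Membership.Propositional using (_∈_)
open import Data.List.Membership.Propositional.Properties
  using (∈-++⁺ˡ; ∈-++⁺ʳ; ∈-allFin; ∈-∃++; ∈-map⁻)
open import Data.List.Relation.Unary.All as All using (All; []; _∷_)
import Data.List.Relation.Unary.All.Properties as All
open import Data.List.Relation.Unary.AllPairs using ([]; _∷_)
open import Data.List.Relation.Unary.Any as Any using (Any; here; there)
open import Data.List.Relation.Unary.Linked using ([-]; _∷_)
open import Data.List.Relation.Unary.Sorted.TotalOrder ≤-totalOrder using (Sorted)
open import Data.List.Relation.Unary.Unique.Propositional using (Unique)
import Data.List.Relation.Unary.Unique.Propositional.Properties as Unique
import Data.List.Relation.Unary.Unique.DecPropositional as UniqueDec
open import Data.List.Relation.Binary.Disjoint.Propositional using (Disjoint)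
open import Data.List.Relation.Binary.Permutation.Propositional as ↭
  using (_↭_; prep; swap; ↭-refl; ↭-sym; ↭-trans; ↭-reflexive; ↭⇒↭ₛ; module PermutationReasoning)
open import Data.List.Relation.Binary.Permutation.Propositional.Properties
  using ( ↭-map-inv; ↭-length; All-resp-↭; ∈-resp-↭; shift; shifts; ++⁺; ++⁺ˡ; ++-comm; ++-identityʳ
        ; ++-commutativeMonoid )
import Data.List.Relation.Binary.Permutation.Setoid.Properties as Permₛ
open import Data.List.Sort ≤-decTotalOrder using (sort; sort-↭; sort-↗)
open import Data.Product as Product using (_×_; _,_; proj₁; proj₂; ∃; ∃₂)
import Data.Product.Properties as Product
open import Data.Sum using (_⊎_; inj₁; inj₂)
open import Function using (_∘_; Injective)
open import Function.Bundles using (_⇔_; mk⇔)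
open import Relation.Binary.PropositionalEquality hiding ([_])
open import Relation.Nullary using (¬_; Dec; yes; no; contradiction)
open import Relation.Nullary.Decidable using (toWitness; _→-dec_; _×-dec_)
open import Algebra.Properties.CommutativeMonoid.Sum +-0-commutativeMonoid
  using (sum; ∑-distrib-+; ∑-comm; sum-replicate-zero; sum-init-last; sum-cong-≗)

-- Degrees in the image of the spider

sum-mono : ∀ {n} {f g : Fin n → ℕ} → (∀ i → f i ≤ g i) → sum f ≤ sum g
sum-mono {zero}  f≤g = z≤n
sum-mono {suc n} f≤g = +-mono-≤ (f≤g zero) (sum-mono (f≤g ∘ suc))

sum-const : ∀ n c → sum {n} (λ _ → c) ≡ n * c
sum-const zero    c = refl
sum-const (suc n) c = cong (c +_) (sum-const n c)

sum≢0⇒∃ : ∀ {n} (f : Fin n → ℕ) → sum f ≢ 0 → ∃ λ i → f i ≢ 0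
sum≢0⇒∃ {zero}  f Σ≢0 = contradiction refl Σ≢0
sum≢0⇒∃ {suc n} f Σ≢0 with f zero ≟ 0
... | no f₀≢0 = zero , f₀≢0
... | yes f₀≡0 =
  let i , fᵢ≢0 = sum≢0⇒∃ (f ∘ suc) (λ Σ≡0 → Σ≢0 (cong₂ _+_ f₀≡0 Σ≡0)) in suc i , fᵢ≢0

-- Turns injectivity into an inequality: when at most one edge can contribute to a count, the bound
-- for a single edge bounds the whole count.
sum-supported-at-one : ∀ {n} (f : Fin n → ℕ) {b} → (∀ i → f i ≤ b) →
  (∀ i j → f i ≢ 0 → f j ≢ 0 → i ≡ j) → sum f ≤ b
sum-supported-at-one {zero}  f f≤b unique = z≤n
sum-supported-at-one {suc n} f {b} f≤b unique with f zero ≟ 0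
... | yes f₀≡0 rewrite f₀≡0 = sum-supported-at-one (f ∘ suc) (f≤b ∘ suc)
        λ i j fᵢ≢0 fⱼ≢0 → Fin.suc-injective (unique (suc i) (suc j) fᵢ≢0 fⱼ≢0)
... | no f₀≢0 with sum (f ∘ suc) ≟ 0
...   | yes Σ≡0 rewrite Σ≡0 = ≤-trans (≤-reflexive (+-identityʳ _)) (f≤b zero)
...   | no Σ≢0 with sum≢0⇒∃ (f ∘ suc) Σ≢0
...     | i , fᵢ≢0 = contradiction (unique zero (suc i) f₀≢0 fᵢ≢0) λ ()

δ : ∀ {k} → Fin k → Fin k → ℕ
δ zero    zero    = 1
δ zero    (suc _) = 0
δ (suc _) zero    = 0
δ (suc a) (suc b) = δ a b

sum-δ : ∀ {k} (a : Fin k) → sum (δ a) ≡ 1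
sum-δ {suc k} zero    = cong suc (sum-replicate-zero k)
sum-δ         (suc a) = sum-δ a

δ≤1 : ∀ {k} (a b : Fin k) → δ a b ≤ 1
δ≤1 zero    zero    = ≤-refl
δ≤1 zero    (suc _) = z≤n
δ≤1 (suc _) zero    = z≤n
δ≤1 (suc a) (suc b) = δ≤1 a b

δ≢0⇒≡ : ∀ {k} (a b : Fin k) → δ a b ≢ 0 → a ≡ b
δ≢0⇒≡ zero    zero    _   = refl
δ≢0⇒≡ zero    (suc _) δ≢0 = contradiction refl δ≢0
δ≢0⇒≡ (suc _) zero    δ≢0 = contradiction refl δ≢0
δ≢0⇒≡ (suc a) (suc b) δ≢0 = cong suc (δ≢0⇒≡ a b δ≢0)

-- A loop at v has two orientations.
orientations : ∀ {k} → Fin k × Fin k → Fin k → Fin k → ℕ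
orientations (a , b) v u = δ a v * δ b u + δ b v * δ a u

δ*δ≢0⇒≡ : ∀ {k} (a v b u : Fin k) → δ a v * δ b u ≢ 0 → a ≡ v × b ≡ u
δ*δ≢0⇒≡ a v b u p≢0 =
  δ≢0⇒≡ a v (λ δ≡0 → p≢0 (cong (_* δ b u) δ≡0)) ,
  δ≢0⇒≡ b u (λ δ≡0 → p≢0 (trans (cong (δ a v *_) δ≡0) (*-zeroʳ (δ a v))))

orientations≢0⇒SamePair : ∀ {k} (p : Fin k × Fin k) v u →
  orientations p v u ≢ 0 → SamePair p (v , u)
orientations≢0⇒SamePair (a , b) v u o≢0 with δ a v * δ b u ≟ 0
... | no  p≢0 = inj₁ (δ*δ≢0⇒≡ a v b u p≢0)
... | yes p≡0 =
  let b≡v , a≡u = δ*δ≢0⇒≡ b v a u (λ q≡0 → o≢0 (cong₂ _+_ p≡0 q≡0)) in inj₂ (a≡u , b≡v)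

-- The value 2 requires both orientations of the edge to be `(v , u)`, which happens only for a
-- loop, and then `δ v u` is 1.
orientations≤ : ∀ {k} (p : Fin k × Fin k) v u → orientations p v u ≤ 1 + δ v u
orientations≤ (a , b) v u with δ a v * δ b u ≟ 0
... | yes p≡0 rewrite p≡0 = ≤-trans (*-mono-≤ (δ≤1 b v) (δ≤1 a u)) (m≤m+n 1 _)
... | no  p≢0 with δ*δ≢0⇒≡ a v b u p≢0
...   | refl , refl = +-mono-≤ (*-mono-≤ (δ≤1 a a) (δ≤1 b b))
          (≤-trans (*-monoˡ-≤ (δ a b) (δ≤1 b a)) (≤-reflexive (*-identityˡ _)))

-- Links the count over neighbours `u` with the contribution of one edge to the degree of `v`, where
-- a loop counts twice.
sum-orientations : ∀ {k} (p : Fin k × Fin k) v →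
  sum (orientations p v) ≡ δ (proj₁ p) v + δ (proj₂ p) v
sum-orientations (a , b) v = begin
  sum (λ u → δ a v * δ b u + δ b v * δ a u)
    ≡⟨ ∑-distrib-+ (λ u → δ a v * δ b u) (λ u → δ b v * δ a u) ⟩
  sum (λ u → δ a v * δ b u) + sum (λ u → δ b v * δ a u)
    ≡⟨ cong₂ _+_ (sum-*δ (δ a v) b) (sum-*δ (δ b v) a) ⟩
  δ a v + δ b v ∎
  where
  open ≡-Reasoning
  *-distribˡ-sum : ∀ c {n} (f : Fin n → ℕ) → sum (λ i → c * f i) ≡ c * sum f
  *-distribˡ-sum c {zero}  f = sym (*-zeroʳ c)
  *-distribˡ-sum c {suc n} f =
    trans (cong (c * f zero +_) (*-distribˡ-sum c (f ∘ suc))) (sym (*-distribˡ-+ c (f zero) _))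
  sum-*δ : ∀ c d → sum (λ u → c * δ d u) ≡ c
  sum-*δ c d = trans (*-distribˡ-sum c (δ d)) (trans (cong (c *_) (sum-δ d)) (*-identityʳ c))

lastOn : {A : Set} {m : ℕ} → A → (Fin m → A) → A
lastOn {m = zero}  c g = c
lastOn {m = suc m} c g = g (fromℕ m)

-- Every inner vertex of a walk is counted once as a source and once as a target.
walk-degree : {A : Set} (h : A → ℕ) (c : A) {m : ℕ} (g : Fin m → A) → 1 ≤ m →
  ∃ λ x → sum (λ j → h (prevOn c g j) + h (g j)) ≡ h c + 2 * x + h (lastOn c g)
walk-degree h c {suc m} g _ = inner , (begin
  sum (λ j → h (prevOn c g j) + h (g j))
    ≡⟨ ∑-distrib-+ (h ∘ prevOn c g) (h ∘ g) ⟩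
  h c + inner + sum (h ∘ g)
    ≡⟨ cong (h c + inner +_) (sum-init-last (h ∘ g)) ⟩
  h c + inner + (inner + last)
    ≡⟨ regroup (h c) inner last ⟩
  h c + 2 * inner + last ∎)
  where
  open ≡-Reasoning
  inner = sum (h ∘ g ∘ inject₁)
  last  = h (g (fromℕ m))
  regroup : ∀ a x b → a + x + (x + b) ≡ a + 2 * x + b
  regroup = solve-∀

module _ {ℓ : Fin 4 → ℕ} where

  legE-injectiveˡ : ∀ {i i'} {j : Fin (ℓ i)} {j' : Fin (ℓ i')} → legE {ℓ} i j ≡ legE i' j' → i ≡ i'
  legE-injectiveˡ refl = refl

  legE-injectiveʳ : ∀ {i} {j j' : Fin (ℓ i)} → legE {ℓ} i j ≡ legE i j' → j ≡ j'
  legE-injectiveʳ refl = refl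

  sumE : (SpiderE ℓ → ℕ) → ℕ
  sumE h = sum λ i → sum λ j → h (legE i j)

  sumE-cong : {g h : SpiderE ℓ → ℕ} → (∀ e → g e ≡ h e) → sumE g ≡ sumE h
  sumE-cong g≗h = sum-cong-≗ λ i → sum-cong-≗ λ j → g≗h (legE i j)

  sumE-comm : ∀ {n} (h : SpiderE ℓ → Fin n → ℕ) →
    sumE (λ e → sum (h e)) ≡ sum (λ v → sumE (λ e → h e v))
  sumE-comm h = trans
    (sum-cong-≗ λ i → ∑-comm (λ j → h (legE i j)))
    (∑-comm λ i v → sum λ j → h (legE i j) v)

  sumE-supported-at-one : (h : SpiderE ℓ → ℕ) {b : ℕ} → (∀ e → h e ≤ b) →
    (∀ e e' → h e ≢ 0 → h e' ≢ 0 → e ≡ e') → sumE h ≤ b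
  sumE-supported-at-one h h≤b unique = sum-supported-at-one _
    (λ i → sum-supported-at-one _ (λ j → h≤b (legE i j)) λ j j' hj≢0 hj'≢0 →
      legE-injectiveʳ (unique (legE i j) (legE i j') hj≢0 hj'≢0))
    λ i i' Σi≢0 Σi'≢0 →
      let j , hj≢0 = sum≢0⇒∃ _ Σi≢0 ; j' , hj'≢0 = sum≢0⇒∃ _ Σi'≢0
      in legE-injectiveˡ (unique (legE i j) (legE i' j') hj≢0 hj'≢0)

injective⇒onto : ∀ {n} {h : Fin n → Fin n} → Injective _≡_ _≡_ h → ∀ y → ∃ λ i → h i ≡ y
-- Among `y` and the n values of `h` two coincide; as `h` is injective, one of the two is `y`.
injective⇒onto {n} {h} h-inj y with pigeonhole (n<1+n n) (λ { zero → y ; (suc i) → h i })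
... | zero  , suc j , _   , y≡hj  = j , sym y≡hj
... | suc i , suc j , i<j , hi≡hj =
  contradiction (cong suc (h-inj hi≡hj)) (Fin.<⇒≢ i<j)

prevOn-0 : {A : Set} {c : A} {m : ℕ} {g : Fin m → A} (0<m : 0 < m) → prevOn c g (fromℕ< 0<m) ≡ c
prevOn-0 (s≤s _) = refl

prevOn-1 : {A : Set} {c : A} {m : ℕ} {g : Fin m → A} (0<m : 0 < m) (1<m : 1 < m) →
  prevOn c g (fromℕ< 1<m) ≡ g (fromℕ< 0<m)
prevOn-1 (s≤s _) (s≤s (s≤s _)) = refl

-- The positions 1 and 0 on the legs already tell the edges apart, so `i` and `j` may coincide.
legE-≢ : ∀ {ℓ : Fin 4 → ℕ} {i j} (0<ℓⱼ : 0 < ℓ j) (1<ℓᵢ : 1 < ℓ i) →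
  legE {ℓ} i (fromℕ< 1<ℓᵢ) ≢ legE j (fromℕ< 0<ℓⱼ)
legE-≢ {ℓ} 0<ℓⱼ 1<ℓᵢ e≡e' = contradiction
  (trans (sym (index-fromℕ< 1<ℓᵢ)) (trans (cong index e≡e') (index-fromℕ< 0<ℓⱼ))) λ ()
  where
  index : SpiderE ℓ → ℕ
  index (legE _ j) = toℕ j
  index-fromℕ< : ∀ {m i} (m<ℓᵢ : m < ℓ i) → index (legE i (fromℕ< m<ℓᵢ)) ≡ m
  index-fromℕ< m<ℓᵢ = Fin.toℕ-fromℕ< m<ℓᵢ

module _ {k : ℕ} {ℓ : Fin 4 → ℕ} (1≤ℓ : ∀ i → 1 ≤ ℓ i) (emb : EmbedsIn (Spider ℓ) k) where

  private
    f = proj₁ emb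
    f-inj = proj₂ emb

    c : Fin k
    c = f centre

    end-of-leg : Fin 4 → Fin k
    end-of-leg i = lastOn c (f ∘ leg i)

    image : SpiderE ℓ → Fin k × Fin k
    image = imageEdge (Spider ℓ) f

    image-leg : ∀ i j → image (legE i j) ≡ (prevOn c (f ∘ leg i) j , f (leg i j))
    image-leg i j = cong (_, f (leg i j)) (f-prevOn j)
      where
      f-prevOn : ∀ {m} {g : Fin m → SpiderV ℓ} (j : Fin m) →
        f (prevOn centre g j) ≡ prevOn c (f ∘ g) j
      f-prevOn zero    = refl
      f-prevOn (suc _) = refl

    incidence : SpiderE ℓ → Fin k → ℕ
    incidence e v = δ (proj₁ (image e)) v + δ (proj₂ (image e)) v

    degree : Fin k → ℕ
    degree v = sumE λ e → incidence e v

    sum-incidence : ∀ e → sum (incidence e) ≡ 2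
    sum-incidence e = trans (∑-distrib-+ (δ (proj₁ (image e))) (δ (proj₂ (image e))))
      (cong₂ _+_ (sum-δ (proj₁ (image e))) (sum-δ (proj₂ (image e))))

    ends : Fin k → ℕ
    ends v = sum λ i → δ (end-of-leg i) v

    first : Fin 4 → Fin k
    first i = f (leg i (fromℕ< (1≤ℓ i)))

    image-0 : ∀ i → image (legE i (fromℕ< (1≤ℓ i))) ≡ (c , first i)
    image-0 i = trans (image-leg i _) (cong (_, first i) (prevOn-0 (1≤ℓ i)))

    -- All first edges share the endpoint `c`, so equal first vertices would give equal image edges.
    first-injective : Injective _≡_ _≡_ first
    first-injective {i} {j} eq = legE-injectiveˡ (f-inj _ _
      (subst₂ SamePair (sym (image-0 i)) (sym (image-0 j)) (inj₁ (refl , eq))))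

  -- For each `u` at most one edge of the spider is mapped onto the edge `vu`, and it contributes at
  -- most 1, or 2 if `u` is `v`.
  degree≤1+k : ∀ v → degree v ≤ 1 + k
  degree≤1+k v = begin
    degree v
      ≡⟨ sumE-cong (λ e → sum-orientations (image e) v) ⟨
    sumE (λ e → sum (orientations (image e) v))
      ≡⟨ sumE-comm (λ e → orientations (image e) v) ⟩
    sum (λ u → sumE λ e → orientations (image e) v u)
      ≤⟨ sum-mono (λ u → sumE-supported-at-one _ (λ e → orientations≤ (image e) v u) λ e e' o≢0 o'≢0 →
           f-inj e e' (SamePair-join (orientations≢0⇒SamePair (image e) v u o≢0)
                                     (orientations≢0⇒SamePair (image e') v u o'≢0))) ⟩
    sum (λ u → 1 + δ v u)
      ≡⟨ ∑-distrib-+ (λ _ → 1) (δ v) ⟩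
    sum {k} (λ _ → 1) + sum (δ v)
      ≡⟨ cong₂ _+_ (trans (sum-const k 1) (*-identityʳ k)) (sum-δ v) ⟩
    k + 1
      ≡⟨ +-comm k 1 ⟩
    1 + k ∎
    where
    open ≤-Reasoning
    SamePair-join : {A : Set} {p q r : A × A} → SamePair p r → SamePair q r → SamePair p q
    SamePair-join (inj₁ (refl , refl)) (inj₁ (refl , refl)) = inj₁ (refl , refl)
    SamePair-join (inj₁ (refl , refl)) (inj₂ (refl , refl)) = inj₂ (refl , refl)
    SamePair-join (inj₂ (refl , refl)) (inj₁ (refl , refl)) = inj₂ (refl , refl)
    SamePair-join (inj₂ (refl , refl)) (inj₂ (refl , refl)) = inj₁ (refl , refl)

  degree-parity : ∀ v → ∃ λ x → degree v ≡ 2 * x + ends v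
  -- The four legs all start at `c`, an even number of incidences, of which `2 * δ c v` is half;
  -- `x i` counts the visits of leg `i` to `v` strictly between its ends.
  degree-parity v = 2 * δ c v + x 0F + x 1F + x 2F + x 3F , (begin
    degree v
      ≡⟨ sum-cong-≗ (λ i → trans
           (sum-cong-≗ λ j → cong (λ p → δ (proj₁ p) v + δ (proj₂ p) v) (image-leg i j))
           (proj₂ (inner i))) ⟩
    sum (λ i → δ c v + 2 * x i + δ (end-of-leg i) v)
      ≡⟨ regroup (δ c v) (x 0F) (x 1F) (x 2F) (x 3F) _ _ _ _ ⟩
    2 * (2 * δ c v + x 0F + x 1F + x 2F + x 3F) + ends v ∎)
    where
    open ≡-Reasoning
    inner = λ i → walk-degree (λ a → δ a v) c (f ∘ leg i) (1≤ℓ i)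
    x = proj₁ ∘ inner
    regroup : ∀ d x₀ x₁ x₂ x₃ e₀ e₁ e₂ e₃ →
      d + 2 * x₀ + e₀ + (d + 2 * x₁ + e₁ + (d + 2 * x₂ + e₂ + (d + 2 * x₃ + e₃ + 0))) ≡
      2 * (2 * d + x₀ + x₁ + x₂ + x₃) + (e₀ + (e₁ + (e₂ + (e₃ + 0))))
    regroup = solve-∀

  -- If some leg ends at `v`, the bound `1 + k` suffices. Otherwise the degree is even and cannot
  -- equal the odd number `1 + k`.
  degree≤k+ends : 2 ∣ k → ∀ v → degree v ≤ k + ends v
  degree≤k+ends (divides t k≡t*2) v with ends v | degree≤1+k v | degree-parity v
  ... | suc e | deg≤1+k | _ = ≤-trans deg≤1+k (≤-trans (m≤m+n (1 + k) e) (≤-reflexive (sym (+-suc k e))))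
  ... | zero  | deg≤1+k | x , deg≡2x+0 = begin
    degree v   ≡⟨ deg≡2x ⟩
    2 * x      ≤⟨ *-monoʳ-≤ 2 (s≤s⁻¹ (*-cancelˡ-< 2 x (suc t) 2x<2[1+t])) ⟩
    2 * t      ≡⟨ trans (*-comm 2 t) (sym k≡t*2) ⟩
    k          ≡⟨ +-identityʳ k ⟨
    k + 0      ∎
    where
    open ≤-Reasoning
    deg≡2x = trans deg≡2x+0 (+-identityʳ (2 * x))
    2x<2[1+t] : 2 * x < 2 * suc t
    2x<2[1+t] = begin-strict
      2 * x          ≡⟨ deg≡2x ⟨
      degree v       ≤⟨ deg≤1+k ⟩
      1 + k          <⟨ ≤-refl ⟩
      2 + k          ≡⟨ cong (2 +_) k≡t*2 ⟩
      suc t * 2      ≡⟨ *-comm (suc t) 2 ⟩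
      2 * suc t      ∎

  -- Double counting of incidences: every edge has two ends, and the four legs have four ends in
  -- total.
  size-bound : 2 ∣ k → 2 * (ℓ 0F + ℓ 1F + ℓ 2F + ℓ 3F) ≤ k * k + 4
  size-bound 2∣k = begin
    2 * (ℓ 0F + ℓ 1F + ℓ 2F + ℓ 3F)
      ≡⟨ regroup (ℓ 0F) (ℓ 1F) (ℓ 2F) (ℓ 3F) ⟩
    sum (λ i → ℓ i * 2)
      ≡⟨ sum-cong-≗ (λ i → sum-const (ℓ i) 2) ⟨
    sumE {ℓ} (λ _ → 2)
      ≡⟨ sumE-cong sum-incidence ⟨
    sumE (λ e → sum (incidence e))
      ≡⟨ sumE-comm incidence ⟩
    sum degree
      ≤⟨ sum-mono (degree≤k+ends 2∣k) ⟩
    sum (λ v → k + ends v)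
      ≡⟨ ∑-distrib-+ (λ _ → k) ends ⟩
    sum {k} (λ _ → k) + sum ends
      ≡⟨ cong₂ _+_ (sum-const k k) (∑-comm λ v i → δ (end-of-leg i) v) ⟩
    k * k + sum (λ i → sum (δ (end-of-leg i)))
      ≡⟨ cong (k * k +_) (sum-cong-≗ λ i → sum-δ (end-of-leg i)) ⟩
    k * k + 4 ∎
    where
    open ≤-Reasoning
    regroup : ∀ a b c d → 2 * (a + b + c + d) ≡ a * 2 + (b * 2 + (c * 2 + (d * 2 + 0)))
    regroup = solve-∀

  4≤order : 4 ≤ k
  4≤order = injective⇒≤ first-injective

  -- In K₄* the first edges of the legs exhaust the edges at c, so the leg that starts with the loop at c has no
  -- second edge.
  unit-leg-in-K₄ : k ≡ 4 → ∃ λ i → ¬ (2 ≤ ℓ i)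
  unit-leg-in-K₄ refl = i , λ 2≤ℓᵢ →
    let second = f (leg i (fromℕ< 2≤ℓᵢ))
        j , first-j≡second = injective⇒onto first-injective second
        image-1 = trans (image-leg i (fromℕ< 2≤ℓᵢ)) (cong (_, second) (trans (prevOn-1 (1≤ℓ i) 2≤ℓᵢ) first-i≡c))
    in legE-≢ (1≤ℓ j) 2≤ℓᵢ (f-inj _ _
         (subst₂ SamePair (sym image-1) (sym (image-0 j)) (inj₁ (refl , sym first-j≡second))))
    where
    i = proj₁ (injective⇒onto first-injective c)
    first-i≡c = proj₂ (injective⇒onto first-injective c)

-- Spiders as edge-disjoint trails

-- The smaller endpoint comes first, so that unordered pairs become comparable by _≡_.
edge : ∀ {k} → Fin k → Fin k → Fin k × Fin k
edge zero    j       = zero , j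
edge (suc i) zero    = zero , suc i
edge (suc i) (suc j) = Product.map suc suc (edge i j)

edge-comm : ∀ {k} (i j : Fin k) → edge i j ≡ edge j i
edge-comm zero    zero    = refl
edge-comm zero    (suc j) = refl
edge-comm (suc i) zero    = refl
edge-comm (suc i) (suc j) = cong (Product.map suc suc) (edge-comm i j)

SamePair⇒edge≡ : ∀ {k} {a b c d : Fin k} → SamePair (a , b) (c , d) → edge a b ≡ edge c d
SamePair⇒edge≡ (inj₁ (refl , refl)) = refl
SamePair⇒edge≡ (inj₂ (refl , refl)) = edge-comm _ _

-- The start is kept apart from the list, so that the length of the list is the number of edges.
trail : ∀ {k} → Fin k → List (Fin k) → List (Fin k × Fin k)
trail s []      = []
trail s (t ∷ w) = edge s t ∷ trail t w

-- K_k* contains a spider whose legs have the lengths ls.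
Realizable : ℕ → List ℕ → Set
Realizable k ls = ∃₂ λ (c : Fin k) (ws : List (List (Fin k))) →
  map length ws ↭ ls × Unique (concatMap (trail c) ws)

realizable-↭ : ∀ {k ls ls'} → ls ↭ ls' → Realizable k ls → Realizable k ls'
realizable-↭ ls↭ls' (c , ws , lengths , uniq) = c , ws , ↭-trans lengths ls↭ls' , uniq

Unique-resp-↭ : ∀ {A : Set} {xs ys : List A} → xs ↭ ys → Unique xs → Unique ys
Unique-resp-↭ xs↭ys = Permₛ.Unique-resp-↭ (setoid _) (↭⇒↭ₛ xs↭ys)

concatMap-↭ : ∀ {A B : Set} (g : A → List B) {xs ys : List A} → xs ↭ ys →
  concatMap g xs ↭ concatMap g ys
concatMap-↭ g ↭.refl         = ↭-refl
concatMap-↭ g (prep x p)     = ++⁺ˡ (g x) (concatMap-↭ g p)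
concatMap-↭ g (swap x y p)   = ↭-trans (shifts (g x) (g y)) (++⁺ˡ (g y) (++⁺ˡ (g x) (concatMap-↭ g p)))
concatMap-↭ g (↭.trans p q)  = ↭-trans (concatMap-↭ g p) (concatMap-↭ g q)

-- Moves the permutation from the lengths to the trails, so that the trails can be matched with `ls`
-- in order.
realizable⇒trails : ∀ {k ls} → Realizable k ls → ∃₂ λ (c : Fin k) (ws : List (List (Fin k))) →
  ls ≡ map length ws × Unique (concatMap (trail c) ws)
realizable⇒trails (c , ws , lengths , uniq) =
  let ws' , ls≡ , ws↭ws' = ↭-map-inv length lengths
  in c , ws' , ls≡ , Unique-resp-↭ (concatMap-↭ (trail c) ws↭ws') uniq

Unique-++⁻ : ∀ {A : Set} (xs : List A) {ys} → Unique (xs ++ ys) → Unique xs × Unique ys × Disjoint xs ys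
Unique-++⁻ []       uniq        = [] , uniq , λ { (() , _) }
Unique-++⁻ (x ∷ xs) (x∉ ∷ uniq) with Unique-++⁻ xs uniq
... | xs! , ys! , disj = All.++⁻ˡ xs x∉ ∷ xs! , ys! , λ where
  (here refl , y∈ys) → All.lookup (All.++⁻ʳ xs x∉) y∈ys refl
  (there x∈xs , y∈ys) → disj (x∈xs , y∈ys)

-- The edges of `trail` indexed by position, in the form in which `spiderEnd` presents the edges of
-- a leg.
edgeAt : ∀ {k} → Fin k → (w : List (Fin k)) → Fin (length w) → Fin k × Fin k
edgeAt c w j = edge (prevOn c (lookup w) j) (lookup w j)

edgeAt-suc : ∀ {k} (c t : Fin k) w j → edgeAt c (t ∷ w) (suc j) ≡ edgeAt t w j
edgeAt-suc c t (_ ∷ _) zero    = refl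
edgeAt-suc c t (_ ∷ _) (suc j) = refl

edgeAt∈trail : ∀ {k} (c : Fin k) w j → edgeAt c w j ∈ trail c w
edgeAt∈trail c (t ∷ w) zero    = here refl
edgeAt∈trail c (t ∷ w) (suc j) rewrite edgeAt-suc c t w j = there (edgeAt∈trail t w j)

edgeAt-injective : ∀ {k} {c : Fin k} {w} → Unique (trail c w) → Injective _≡_ _≡_ (edgeAt c w)
edgeAt-injective {w = _ ∷ _} _ {zero} {zero} _ = refl
edgeAt-injective {c = c} {t ∷ w} (e∉ ∷ _) {zero} {suc j} eq =
  contradiction (trans eq (edgeAt-suc c t w j)) (All.lookup e∉ (edgeAt∈trail t w j))
edgeAt-injective {c = c} {t ∷ w} (e∉ ∷ _) {suc i} {zero} eq =
  contradiction (trans (sym eq) (edgeAt-suc c t w i)) (All.lookup e∉ (edgeAt∈trail t w i))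
edgeAt-injective {c = c} {t ∷ w} (_ ∷ uniq) {suc i} {suc j} eq =
  cong suc (edgeAt-injective uniq
    (trans (sym (edgeAt-suc c t w i)) (trans eq (edgeAt-suc c t w j))))

edgeAt∈trails : ∀ {k} (c : Fin k) ws i j → edgeAt c (lookup ws i) j ∈ concatMap (trail c) ws
edgeAt∈trails c (w ∷ ws) zero    j = ∈-++⁺ˡ (edgeAt∈trail c w j)
edgeAt∈trails c (w ∷ ws) (suc i) j = ∈-++⁺ʳ (trail c w) (edgeAt∈trails c ws i j)

-- Different legs have disjoint edge lists, and within one leg `edgeAt-injective` applies. Positions
-- are compared as numbers because `j` and `j'` share a type only once `i ≡ i'` is known.
edgeAt-injective₂ : ∀ {k} (c : Fin k) ws → Unique (concatMap (trail c) ws) → ∀ i i' j j' →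
  edgeAt c (lookup ws i) j ≡ edgeAt c (lookup ws i') j' → i ≡ i' × toℕ j ≡ toℕ j'
edgeAt-injective₂ c (w ∷ ws) uniq i i' j j' eq with Unique-++⁻ (trail c w) uniq
edgeAt-injective₂ c (w ∷ ws) _ zero zero j j' eq | w! , _ , _ =
  refl , cong toℕ (edgeAt-injective w! eq)
edgeAt-injective₂ c (w ∷ ws) _ zero (suc i') j j' eq | _ , _ , disj =
  contradiction (edgeAt∈trail c w j , subst (_∈ concatMap (trail c) ws) (sym eq) (edgeAt∈trails c ws i' j')) disj
edgeAt-injective₂ c (w ∷ ws) _ (suc i) zero j j' eq | _ , _ , disj =
  contradiction (edgeAt∈trail c w j' , subst (_∈ concatMap (trail c) ws) eq (edgeAt∈trails c ws i j)) disj
edgeAt-injective₂ c (w ∷ ws) _ (suc i) (suc i') j j' eq | _ , ws! , _ =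
  Product.map₁ (cong suc) (edgeAt-injective₂ c ws ws! i i' j j' eq)

-- Each leg of the spider follows an initial segment of its trail, so shorter legs are covered as
-- well.
realizable⇒embeds : ∀ {k a b c d} → Realizable k (a ∷ b ∷ c ∷ d ∷ []) → (ℓ : Fin 4 → ℕ) →
  ℓ 0F ≤ a → ℓ 1F ≤ b → ℓ 2F ≤ c → ℓ 3F ≤ d → EmbedsIn (Spider ℓ) k
realizable⇒embeds {k} R ℓ ℓ₀≤a ℓ₁≤b ℓ₂≤c ℓ₃≤d with realizable⇒trails R
... | c , ws@(w₀ ∷ w₁ ∷ w₂ ∷ w₃ ∷ []) , refl , uniq = f , f-injective
  where
  ℓ≤ : ∀ i → ℓ i ≤ length (lookup ws i)
  ℓ≤ 0F = ℓ₀≤a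
  ℓ≤ 1F = ℓ₁≤b
  ℓ≤ 2F = ℓ₂≤c
  ℓ≤ 3F = ℓ₃≤d

  f : SpiderV ℓ → Fin k
  f centre    = c
  f (leg i j) = lookup (lookup ws i) (inject≤ j (ℓ≤ i))

  prevOn-inject≤ : ∀ {m n} (h : Fin n → Fin k) (m≤n : m ≤ n) (g : Fin m → SpiderV ℓ) →
    (∀ j → f (g j) ≡ h (inject≤ j m≤n)) → ∀ j →
    f (prevOn centre g j) ≡ prevOn c h (inject≤ j m≤n)
  prevOn-inject≤ {suc m} {suc n} h m≤n g fg≡h zero    = refl
  prevOn-inject≤ {suc m} {suc n} h m≤n g fg≡h (suc j) = trans (fg≡h (inject₁ j))
    (cong h (toℕ-injective (begin
      toℕ (inject≤ (inject₁ j) m≤n)            ≡⟨ toℕ-inject≤ (inject₁ j) m≤n ⟩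
      toℕ (inject₁ j)                          ≡⟨ toℕ-inject₁ j ⟩
      toℕ j                                    ≡⟨ toℕ-inject≤ j (s≤s⁻¹ m≤n) ⟨
      toℕ (inject≤ j (s≤s⁻¹ m≤n))              ≡⟨ toℕ-inject₁ _ ⟨
      toℕ (inject₁ (inject≤ j (s≤s⁻¹ m≤n)))    ∎)))
    where open ≡-Reasoning

  image-leg : ∀ i j → imageEdge (Spider ℓ) f (legE i j) ≡
    (prevOn c (lookup (lookup ws i)) (inject≤ j (ℓ≤ i)) , lookup (lookup ws i) (inject≤ j (ℓ≤ i)))
  image-leg i j = cong (_, lookup (lookup ws i) (inject≤ j (ℓ≤ i)))
    (prevOn-inject≤ (lookup (lookup ws i)) (ℓ≤ i) (leg i) (λ _ → refl) j)

  legE-cong : ∀ {i i'} {j : Fin (ℓ i)} {j' : Fin (ℓ i')} → i ≡ i' → toℕ j ≡ toℕ j' → legE {ℓ} i j ≡ legE i' j'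
  legE-cong refl eq = cong (legE _) (toℕ-injective eq)

  f-injective : (e e' : SpiderE ℓ) → SamePair (imageEdge (Spider ℓ) f e) (imageEdge (Spider ℓ) f e') → e ≡ e'
  f-injective (legE i j) (legE i' j') same =
    let i≡i' , j≡j' = edgeAt-injective₂ c ws uniq i i' (inject≤ j (ℓ≤ i)) (inject≤ j' (ℓ≤ i'))
          (SamePair⇒edge≡ (subst₂ SamePair (image-leg i j) (image-leg i' j') same))
    in legE-cong i≡i' (trans (sym (toℕ-inject≤ j (ℓ≤ i))) (trans j≡j' (toℕ-inject≤ j' (ℓ≤ i'))))

-- Two new vertices

-- The two new vertices of K_{k+2}* are 0 and 1.
old : ∀ {k} → Fin k → Fin (2 + k)
old z = suc (suc z)

oldEdge : ∀ {k} → Fin k × Fin k → Fin (2 + k) × Fin (2 + k)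
oldEdge = Product.map old old

spokes : ∀ {k} → Fin k → List (Fin (2 + k) × Fin (2 + k))
spokes z = (0F , old z) ∷ (1F , old z) ∷ []

loops : ∀ {k} → List (Fin (2 + k) × Fin (2 + k))
loops = (0F , 0F) ∷ (1F , 1F) ∷ []

flatten : {A : Set} → List (A × A) → List A
flatten = concatMap λ (a , b) → a ∷ b ∷ []

-- Each pair contributes a closed walk of length 4 from `0F` through `a`, `1F` and `b`, which uses
-- exactly the spokes at `a` and `b`.
rounds : ∀ {k} → List (Fin k × Fin k) → List (Fin (2 + k))
rounds = concatMap λ (a , b) → old a ∷ 1F ∷ old b ∷ 0F ∷ []

trail-old : ∀ {k} (c : Fin k) w → trail (old c) (map old w) ≡ map oldEdge (trail c w)
trail-old c []      = refl
trail-old c (t ∷ w) = cong (oldEdge (edge c t) ∷_) (trail-old t w)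

trails-old : ∀ {k} (c : Fin k) ws →
  concatMap (trail (old c)) (map (map old) ws) ≡ map oldEdge (concatMap (trail c) ws)
trails-old c []       = refl
trails-old c (w ∷ ws) = trans (cong₂ _++_ (trail-old c w) (trails-old c ws))
  (sym (map-++ oldEdge (trail c w) _))

trail-rounds : ∀ {k} (ps : List (Fin k × Fin k)) w →
  trail 0F (rounds ps ++ w) ↭ concatMap spokes (flatten ps) ++ trail 0F w
trail-rounds []       w = ↭-refl
trail-rounds ((a , b) ∷ ps) w =
  prep (0F , old a) (prep (1F , old a) (swap (1F , old b) (0F , old b) (trail-rounds ps w)))

length-rounds : ∀ {k} (ps : List (Fin k × Fin k)) w →
  length (rounds ps ++ w) ≡ 4 * length ps + length w
length-rounds []       w = refl
length-rounds (p ∷ ps) w = trans (cong (4 +_) (length-rounds ps w)) (regroup (length ps) (length w))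
  where
  regroup : ∀ p w → 4 + (4 * p + w) ≡ 4 * suc p + w
  regroup = solve-∀

module _ {k : ℕ} (x z : Fin k) (ps : List (Fin k × Fin k)) (w : List (Fin k)) where

  -- At `x` the closed trail from `x` to `0F`, around `rounds ps`, then through `z` and `1F` back to
  -- `x` is inserted; it uses all spokes at `x`, `z` and the vertices of `ps`.
  detour : List (Fin (2 + k))
  detour = old x ∷ 0F ∷ rounds ps ++ old z ∷ 1F ∷ old x ∷ map old w

  detourWithLoops : List (Fin (2 + k))
  detourWithLoops = old x ∷ 0F ∷ 0F ∷ rounds ps ++ old z ∷ 1F ∷ 1F ∷ old x ∷ map old w

  length-detour : length detour ≡ 4 * suc (length ps) + suc (length w)
  length-detour = trans (cong (2 +_) (length-rounds ps _))
    (trans (cong (λ l → 2 + (4 * length ps + (3 + l))) (length-map old w)) (regroup (length ps) (length w)))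
    where
    regroup : ∀ p w → 2 + (4 * p + (3 + w)) ≡ 4 * suc p + suc w
    regroup = solve-∀

  length-detourWithLoops : length detourWithLoops ≡ 4 * suc (length ps) + 2 + suc (length w)
  length-detourWithLoops = trans (cong (3 +_) (length-rounds ps _))
    (trans (cong (λ l → 3 + (4 * length ps + (4 + l))) (length-map old w)) (regroup (length ps) (length w)))
    where
    regroup : ∀ p w → 3 + (4 * p + (4 + w)) ≡ 4 * suc p + 2 + suc w
    regroup = solve-∀

  open import Algebra.Solver.CommutativeMonoid (++-commutativeMonoid {A = Fin (2 + k) × Fin (2 + k)})
    using (solve; _⊕_; _⊜_)
  open PermutationReasoning

  private
    S = concatMap spokes (flatten ps)
    T = trail (old x) (map old w)

  trail-detour : ∀ c → trail (old c) detour ↭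
    map oldEdge (trail c (x ∷ w)) ++ concatMap spokes (x ∷ z ∷ flatten ps)
  trail-detour c = begin
    [ oldEdge (edge c x) ] ++ [ 0F , old x ] ++ trail 0F (rounds ps ++ old z ∷ 1F ∷ old x ∷ map old w)
      ↭⟨ ++⁺ˡ ([ oldEdge (edge c x) ] ++ [ 0F , old x ]) (trail-rounds ps (old z ∷ 1F ∷ old x ∷ map old w)) ⟩
    [ oldEdge (edge c x) ] ++ [ 0F , old x ] ++ S ++ [ 0F , old z ] ++ [ 1F , old z ] ++ [ 1F , old x ] ++ T
      ↭⟨ solve 7 (λ e x₀ s z₀ z₁ x₁ t →
           e ⊕ (x₀ ⊕ (s ⊕ (z₀ ⊕ (z₁ ⊕ (x₁ ⊕ t))))) ⊜ e ⊕ (t ⊕ (x₀ ⊕ (x₁ ⊕ (z₀ ⊕ (z₁ ⊕ s)))))) ↭-refl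
           [ oldEdge (edge c x) ] [ 0F , old x ] S [ 0F , old z ] [ 1F , old z ] [ 1F , old x ] T ⟩
    oldEdge (edge c x) ∷ T ++ concatMap spokes (x ∷ z ∷ flatten ps)
      ≡⟨ cong (λ t → oldEdge (edge c x) ∷ t ++ concatMap spokes (x ∷ z ∷ flatten ps)) (trail-old x w) ⟩
    map oldEdge (trail c (x ∷ w)) ++ concatMap spokes (x ∷ z ∷ flatten ps) ∎

  trail-detourWithLoops : ∀ c → trail (old c) detourWithLoops ↭
    map oldEdge (trail c (x ∷ w)) ++ loops ++ concatMap spokes (x ∷ z ∷ flatten ps)
  trail-detourWithLoops c = begin
    [ oldEdge (edge c x) ] ++ [ 0F , old x ] ++ [ 0F , 0F ] ++
    trail 0F (rounds ps ++ old z ∷ 1F ∷ 1F ∷ old x ∷ map old w)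
      ↭⟨ ++⁺ˡ ([ oldEdge (edge c x) ] ++ [ 0F , old x ] ++ [ 0F , 0F ])
           (trail-rounds ps (old z ∷ 1F ∷ 1F ∷ old x ∷ map old w)) ⟩
    [ oldEdge (edge c x) ] ++ [ 0F , old x ] ++ [ 0F , 0F ] ++ S ++
    [ 0F , old z ] ++ [ 1F , old z ] ++ [ 1F , 1F ] ++ [ 1F , old x ] ++ T
      ↭⟨ solve 9 (λ e x₀ l₀ s z₀ z₁ l₁ x₁ t →
           e ⊕ (x₀ ⊕ (l₀ ⊕ (s ⊕ (z₀ ⊕ (z₁ ⊕ (l₁ ⊕ (x₁ ⊕ t))))))) ⊜
           e ⊕ (t ⊕ (l₀ ⊕ (l₁ ⊕ (x₀ ⊕ (x₁ ⊕ (z₀ ⊕ (z₁ ⊕ s)))))))) ↭-refl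
           [ oldEdge (edge c x) ] [ 0F , old x ] [ 0F , 0F ] S [ 0F , old z ] [ 1F , old z ] [ 1F , 1F ]
           [ 1F , old x ] T ⟩
    oldEdge (edge c x) ∷ T ++ loops ++ concatMap spokes (x ∷ z ∷ flatten ps)
      ≡⟨ cong (λ t → oldEdge (edge c x) ∷ t ++ loops ++ concatMap spokes (x ∷ z ∷ flatten ps)) (trail-old x w) ⟩
    map oldEdge (trail c (x ∷ w)) ++ loops ++ concatMap spokes (x ∷ z ∷ flatten ps) ∎

IsSpoke : ∀ {k} → List (Fin k) → Fin (2 + k) × Fin (2 + k) → Set
IsSpoke zs e = ∃ λ z → z ∈ zs × (e ≡ (0F , old z) ⊎ e ≡ (1F , old z))

∈-spokes⁻ : ∀ {k} (zs : List (Fin k)) {e} → e ∈ concatMap spokes zs → IsSpoke zs e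
∈-spokes⁻ (z ∷ zs) (here e≡)         = z , here refl , inj₁ e≡
∈-spokes⁻ (z ∷ zs) (there (here e≡)) = z , here refl , inj₂ e≡
∈-spokes⁻ (z ∷ zs) (there (there e∈)) = Product.map₂ (Product.map₁ there) (∈-spokes⁻ zs e∈)

spokes-unique : ∀ {k} {zs : List (Fin k)} → Unique zs → Unique (concatMap spokes zs)
spokes-unique [] = []
spokes-unique {zs = z ∷ zs} (z∉ ∷ zs!) =
  ((λ ()) ∷ All.tabulate (λ e∈ → new₀ (∈-spokes⁻ zs e∈))) ∷
  (All.tabulate (λ e∈ → new₁ (∈-spokes⁻ zs e∈))) ∷ spokes-unique zs!
  where
  new₀ : ∀ {e} → IsSpoke zs e → (0F , old z) ≢ e
  new₀ (z' , z'∈ , inj₁ refl) refl = All.lookup z∉ z'∈ refl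
  new₀ (z' , z'∈ , inj₂ refl) ()
  new₁ : ∀ {e} → IsSpoke zs e → (1F , old z) ≢ e
  new₁ (z' , z'∈ , inj₁ refl) ()
  new₁ (z' , z'∈ , inj₂ refl) refl = All.lookup z∉ z'∈ refl

-- The three groups of edges differ in how many of their two endpoints are new: none, both, and one.
extension-unique : ∀ {k} {es : List (Fin k × Fin k)} {zs} → Unique es → Unique zs →
  Unique (map oldEdge es ++ loops ++ concatMap spokes zs)
extension-unique {es = es} {zs} es! zs! = Unique.++⁺ (Unique.map⁺ (λ { refl → refl }) es!)
  (((λ ()) ∷ All.tabulate (λ e∈ → not-loop₀ (∈-spokes⁻ zs e∈))) ∷
   (All.tabulate (λ e∈ → not-loop₁ (∈-spokes⁻ zs e∈))) ∷ spokes-unique zs!)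
  λ (e∈old , e∈new) → disjoint (∈-map⁻ oldEdge e∈old) e∈new
  where
  not-loop₀ : ∀ {e} → IsSpoke zs e → (0F , 0F) ≢ e
  not-loop₀ (z , _ , inj₁ refl) ()
  not-loop₀ (z , _ , inj₂ refl) ()
  not-loop₁ : ∀ {e} → IsSpoke zs e → (1F , 1F) ≢ e
  not-loop₁ (z , _ , inj₁ refl) ()
  not-loop₁ (z , _ , inj₂ refl) ()
  disjoint : ∀ {e} → (∃ λ e' → e' ∈ es × e ≡ oldEdge e') → ¬ (e ∈ loops ++ concatMap spokes zs)
  disjoint (_ , _ , refl) (here ())
  disjoint (_ , _ , refl) (there (here ()))
  disjoint (_ , _ , refl) (there (there e∈)) with ∈-spokes⁻ zs e∈
  ... | _ , _ , inj₁ ()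
  ... | _ , _ , inj₂ ()

∈⇒↭ : {A : Set} {x : A} {xs : List A} → x ∈ xs → ∃ λ ys → xs ↭ x ∷ ys
∈⇒↭ {x = x} x∈xs with ∈-∃++ x∈xs
... | ys , zs , refl = ys ++ zs , shift x ys zs

allFin-↭ : ∀ {k} {x y : Fin k} → x ≢ y → ∃ λ zs → allFin k ↭ x ∷ y ∷ zs
allFin-↭ {k} {x} {y} x≢y with ∈⇒↭ (∈-allFin x)
... | xs , all↭x∷xs with ∈-resp-↭ all↭x∷xs (∈-allFin y)
... | here y≡x = contradiction (sym y≡x) x≢y
... | there y∈xs = let zs , xs↭y∷zs = ∈⇒↭ y∈xs in zs , ↭-trans all↭x∷xs (prep x xs↭y∷zs)

pairUp : {A : Set} (n : ℕ) (zs : List A) → length zs ≡ n * 2 → ∃ λ ps → length ps ≡ n × flatten ps ≡ zs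
pairUp zero    []           refl = [] , refl , refl
pairUp (suc n) (a ∷ b ∷ zs) eq with pairUp n zs (cong (_∸ 2) eq)
... | ps , refl , refl = (a , b) ∷ ps , refl , refl

-- Distributes the remaining old vertices, in pairs, over the two closed trails.
splitPairs : {A : Set} (m n : ℕ) (zs : List A) → length zs ≡ (m + n) * 2 →
  ∃₂ λ ps qs → length ps ≡ m × length qs ≡ n × flatten ps ++ flatten qs ≡ zs
splitPairs m n zs eq with pairUp (m + n) zs eq
... | ps , len , refl = take m ps , drop m ps ,
  trans (length-take m ps) (trans (cong (m ⊓_) len) (m≤n⇒m⊓n≡m (m≤m+n m n))) ,
  trans (length-drop m ps) (trans (cong (_∸ m) len) (m+n∸m≡n m n)) ,
  trans (sym (concatMap-++ _ (take m ps) (drop m ps))) (cong flatten (take++drop≡id m ps))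

map-length-old : ∀ {k} (ws : List (List (Fin k))) → map length (map (map old) ws) ≡ map length ws
map-length-old []       = refl
map-length-old (w ∷ ws) = cong₂ _∷_ (length-map old w) (map-length-old ws)

module _ {k : ℕ} {c : Fin k} (wx wy : List (Fin k)) (ws : List (List (Fin k)))
  (x' y' : List (Fin (2 + k))) (zx zy : List (Fin k)) where

  private
    X = trail c wx
    Y = trail c wy
    W = concatMap (trail c) ws

  -- `zx` and `zy` are the old vertices whose spokes go to the first and to the second leg; distinct
  -- vertices have distinct spokes.
  legs-extended : Unique (concatMap (trail c) (wx ∷ wy ∷ ws)) → Unique (zy ++ zx) →
    trail (old c) x' ↭ map oldEdge X ++ concatMap spokes zx →
    trail (old c) y' ↭ map oldEdge Y ++ loops ++ concatMap spokes zy →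
    Unique (concatMap (trail (old c)) (x' ∷ y' ∷ map (map old) ws))
  legs-extended old! zs! x'↭ y'↭ = Unique-resp-↭ (↭-sym all-edges) (extension-unique old! zs!)
    where
    open PermutationReasoning
    open import Algebra.Solver.CommutativeMonoid (++-commutativeMonoid {A = Fin (2 + k) × Fin (2 + k)})
      using (solve; _⊕_; _⊜_)
    Zx = concatMap spokes zx
    Zy = concatMap spokes zy
    all-edges : concatMap (trail (old c)) (x' ∷ y' ∷ map (map old) ws) ↭
      map oldEdge (X ++ Y ++ W) ++ loops ++ concatMap spokes (zy ++ zx)
    all-edges = begin
      trail (old c) x' ++ trail (old c) y' ++ concatMap (trail (old c)) (map (map old) ws)
        ↭⟨ ++⁺ x'↭ (++⁺ y'↭ (↭-reflexive (trails-old c ws))) ⟩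
      (map oldEdge X ++ Zx) ++ (map oldEdge Y ++ loops ++ Zy) ++ map oldEdge W
        ↭⟨ solve 6 (λ x zx y l zy w → (x ⊕ zx) ⊕ ((y ⊕ (l ⊕ zy)) ⊕ w) ⊜ (x ⊕ (y ⊕ w)) ⊕ (l ⊕ (zy ⊕ zx)))
             ↭-refl (map oldEdge X) Zx (map oldEdge Y) loops Zy (map oldEdge W) ⟩
      (map oldEdge X ++ map oldEdge Y ++ map oldEdge W) ++ loops ++ Zy ++ Zx
        ≡⟨ cong₂ (λ es zs → es ++ loops ++ zs)
             (trans (map-++ oldEdge X (Y ++ W)) (cong (map oldEdge X ++_) (map-++ oldEdge Y W)))
             (concatMap-++ spokes zy zx) ⟨
      map oldEdge (X ++ Y ++ W) ++ loops ++ concatMap spokes (zy ++ zx) ∎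

-- Closed trails through the new vertices are inserted at the first vertices x and y of two legs; x ≢ y because the
-- two legs start with different edges.
extend : ∀ {s a b ls} p q → p + suc q ≡ s → Realizable (s * 2) (suc a ∷ suc b ∷ ls) →
  Realizable (suc s * 2) (4 * p + suc a ∷ 4 * suc q + 2 + suc b ∷ ls)
extend p q refl R with realizable⇒trails R
... | c , ((x ∷ wx) ∷ (y ∷ wy) ∷ ws) , refl , uniq@(cx∉ ∷ _)
  with allFin-↭ {x = x} {y} (λ { refl → All.lookup (All.++⁻ʳ (trail x wx) cx∉) (here refl) refl })
... | zs , all↭ = go p zs all↭ (trans (sym (↭-length all↭)) (length-tabulate {n = (p + suc q) * 2} (λ i → i))) uniq
  where
  -- Here `k` is a variable, tied to `p` only through the number of old vertices, so that `p` can be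
  -- split into cases.
  go : ∀ {k} {c x y : Fin k} {wx wy ws} p zs → allFin k ↭ x ∷ y ∷ zs → 2 + length zs ≡ (p + suc q) * 2 →
    Unique (concatMap (trail c) ((x ∷ wx) ∷ (y ∷ wy) ∷ ws)) →
    Realizable (2 + k) (4 * p + suc (length wx) ∷ 4 * suc q + 2 + suc (length wy) ∷ map length ws)
  -- With p = 0 the first leg stays as it is, and `x` serves as the partner of `y` in the single
  -- closed trail.
  go {c = c} {x} {y} {wx} {wy} {ws} zero zs all↭ len uniq with pairUp q zs (cong (_∸ 2) len)
  ... | ps , refl , refl =
    old c , (map old (x ∷ wx) ∷ detourWithLoops y x ps wy ∷ map (map old) ws) ,
    ↭-reflexive (cong₂ _∷_ (length-map old (x ∷ wx))
      (cong₂ _∷_ (length-detourWithLoops y x ps wy) (map-length-old ws))) ,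
    legs-extended (x ∷ wx) (y ∷ wy) ws (map old (x ∷ wx)) (detourWithLoops y x ps wy)
      [] (y ∷ x ∷ flatten ps) uniq
      (Unique-resp-↭ (↭-trans all↭ (↭-trans (swap x y ↭-refl) (↭-sym (++-identityʳ _)))) (Unique.allFin⁺ _))
      (↭-trans (↭-reflexive (trail-old c (x ∷ wx))) (↭-sym (++-identityʳ _)))
      (trail-detourWithLoops y x ps wy c)
  -- Both legs grow: `x` and `y` get the partners `x₁` and `y₁`, and the remaining p + q pairs are
  -- made into rounds.
  go {c = c} {x} {y} {wx} {wy} {ws} (suc p) (x₁ ∷ y₁ ∷ zs) all↭ len uniq
    with splitPairs p q zs (cong (_∸ 4) (trans len (cong (λ m → 2 + m * 2) (+-suc p q))))
  ... | ps , qs , refl , refl , refl =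
    old c , (detour x x₁ ps wx ∷ detourWithLoops y y₁ qs wy ∷ map (map old) ws) ,
    ↭-reflexive (cong₂ _∷_ (length-detour x x₁ ps wx)
      (cong₂ _∷_ (length-detourWithLoops y y₁ qs wy) (map-length-old ws))) ,
    legs-extended (x ∷ wx) (y ∷ wy) ws (detour x x₁ ps wx) (detourWithLoops y y₁ qs wy)
      (x ∷ x₁ ∷ flatten ps) (y ∷ y₁ ∷ flatten qs) uniq
      (Unique-resp-↭ (↭-trans all↭ (solve 6 (λ x y x₁ y₁ ps qs →
           x ⊕ (y ⊕ (x₁ ⊕ (y₁ ⊕ (ps ⊕ qs)))) ⊜ (y ⊕ (y₁ ⊕ qs)) ⊕ (x ⊕ (x₁ ⊕ ps)))
           ↭-refl (x ∷ []) (y ∷ []) (x₁ ∷ []) (y₁ ∷ []) (flatten ps) (flatten qs))) (Unique.allFin⁺ _))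
      (trail-detour x x₁ ps wx c)
      (trail-detourWithLoops y y₁ qs wy c)
    where
    open import Algebra.Solver.CommutativeMonoid (++-commutativeMonoid {A = Fin _})
      using (solve; _⊕_; _⊜_)
  go (suc p) [] _ len _ with trans (cong (_∸ 2) len) (cong (_* 2) (+-suc p q))
  ... | ()
  go (suc p) (_ ∷ []) _ len _ with trans (cong (_∸ 2) len) (cong (_* 2) (+-suc p q))
  ... | ()

-- Tables for k = 4 and k = 6

Legs : ℕ → Set
Legs k = List (List (Fin k))

EdgeDisjoint : ∀ {k} → Legs (suc k) → Set
EdgeDisjoint ws = Unique (concatMap (trail 0F) ws)

edgeDisjoint? : ∀ {k} (ws : Legs (suc k)) → Dec (EdgeDisjoint ws)
edgeDisjoint? ws = UniqueDec.unique? (Product.≡-dec Fin._≟_ Fin._≟_) (concatMap (trail 0F) ws)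

-- The longest leg is determined by the others because the lengths add up to n.
Covers : ∀ {k} (lo hi n : ℕ) → List (Legs k) → Set
Covers lo hi n table = ∀ {a} → a < suc hi → ∀ {b} → b < suc n → ∀ {c} → c < suc n →
  lo ≤ a → a ≤ b → b ≤ c → c ≤ n ∸ (a + b + c) →
  Any (λ ws → map length ws ≡ a ∷ b ∷ c ∷ n ∸ (a + b + c) ∷ []) table

covers? : ∀ {k} lo hi n (table : List (Legs k)) → Dec (Covers lo hi n table)
covers? lo hi n table =
  allUpTo? (λ a → allUpTo? (λ b → allUpTo? (λ c →
    lo ≤? a →-dec (a ≤? b →-dec (b ≤? c →-dec (c ≤? n ∸ (a + b + c) →-dec
      Any.any? (λ ws → ≡-dec _≟_ (map length ws) (a ∷ b ∷ c ∷ n ∸ (a + b + c) ∷ [])) table))))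
    (suc n)) (suc n)) (suc hi)

table⇒realizable : ∀ {k lo hi n} {table : List (Legs (suc k))} → All EdgeDisjoint table → Covers lo hi n table →
  ∀ {a b c d} → lo ≤ a → a ≤ hi → a ≤ b → b ≤ c → c ≤ d → a + b + c + d ≡ n →
  Realizable (suc k) (a ∷ b ∷ c ∷ d ∷ [])
table⇒realizable {n = n} disjoint covers {a} {b} {c} {d} lo≤a a≤hi a≤b b≤c c≤d sum≡n =
  let d≡ = trans (sym (m+n∸m≡n (a + b + c) d)) (cong (_∸ (a + b + c)) sum≡n)
      a+b+c≤n = subst (a + b + c ≤_) sum≡n (m≤m+n (a + b + c) d)
      entry = covers (s≤s a≤hi)
        (s≤s (≤-trans (≤-trans (m≤n+m b a) (m≤m+n (a + b) c)) a+b+c≤n))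
        (s≤s (≤-trans (m≤n+m c (a + b)) a+b+c≤n))
        lo≤a a≤b b≤c (subst (c ≤_) d≡ c≤d)
      ws! , lengths = All.lookupAny disjoint entry
  in 0F , Any.lookup entry , ↭-reflexive (trans lengths (cong (λ d → a ∷ b ∷ c ∷ d ∷ []) (sym d≡))) , ws!

-- Ten edges are all of K₄*, so every entry is a decomposition of it into four trails from `0F`.
table₄ : List (Legs 4)
table₄ =
  ((3F ∷ []) ∷ (1F ∷ []) ∷ (0F ∷ []) ∷ (2F ∷ 3F ∷ 3F ∷ 1F ∷ 1F ∷ 2F ∷ 2F ∷ []) ∷ []) ∷
  ((2F ∷ []) ∷ (0F ∷ []) ∷ (3F ∷ 3F ∷ []) ∷ (1F ∷ 1F ∷ 3F ∷ 2F ∷ 2F ∷ 1F ∷ []) ∷ []) ∷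
  ((0F ∷ []) ∷ (2F ∷ []) ∷ (3F ∷ 3F ∷ 1F ∷ []) ∷ (1F ∷ 1F ∷ 2F ∷ 2F ∷ 3F ∷ []) ∷ []) ∷
  ((2F ∷ []) ∷ (0F ∷ []) ∷ (3F ∷ 2F ∷ 2F ∷ 1F ∷ []) ∷ (1F ∷ 1F ∷ 3F ∷ 3F ∷ []) ∷ []) ∷
  ((0F ∷ []) ∷ (2F ∷ 1F ∷ []) ∷ (3F ∷ 3F ∷ []) ∷ (1F ∷ 1F ∷ 3F ∷ 2F ∷ 2F ∷ []) ∷ []) ∷
  ((0F ∷ []) ∷ (2F ∷ 1F ∷ []) ∷ (3F ∷ 2F ∷ 2F ∷ []) ∷ (1F ∷ 1F ∷ 3F ∷ 3F ∷ []) ∷ []) ∷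
  ((0F ∷ []) ∷ (3F ∷ 3F ∷ 1F ∷ []) ∷ (1F ∷ 1F ∷ 2F ∷ []) ∷ (2F ∷ 2F ∷ 3F ∷ []) ∷ []) ∷
  []

-- K₆* has 21 edges, so every entry leaves out exactly one.
table₆ : List (Legs 6)
table₆ =
  ((5F ∷ 1F ∷ []) ∷ (2F ∷ 3F ∷ []) ∷ (1F ∷ 4F ∷ []) ∷
   (3F ∷ 3F ∷ 5F ∷ 5F ∷ 4F ∷ 2F ∷ 2F ∷ 1F ∷ 1F ∷ 3F ∷ 4F ∷ 4F ∷ 0F ∷ 0F ∷ []) ∷ []) ∷
  ((4F ∷ 3F ∷ []) ∷ (0F ∷ 1F ∷ []) ∷ (2F ∷ 3F ∷ 5F ∷ []) ∷
   (5F ∷ 4F ∷ 4F ∷ 1F ∷ 5F ∷ 5F ∷ 2F ∷ 2F ∷ 1F ∷ 1F ∷ 3F ∷ 3F ∷ 0F ∷ []) ∷ []) ∷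
  ((5F ∷ 1F ∷ []) ∷ (3F ∷ 3F ∷ []) ∷ (0F ∷ 2F ∷ 5F ∷ 5F ∷ []) ∷
   (1F ∷ 1F ∷ 3F ∷ 2F ∷ 1F ∷ 4F ∷ 4F ∷ 5F ∷ 3F ∷ 4F ∷ 2F ∷ 2F ∷ []) ∷ []) ∷
  ((5F ∷ 4F ∷ []) ∷ (4F ∷ 3F ∷ []) ∷ (3F ∷ 2F ∷ 1F ∷ 1F ∷ 0F ∷ []) ∷
   (0F ∷ 2F ∷ 4F ∷ 4F ∷ 1F ∷ 3F ∷ 3F ∷ 5F ∷ 5F ∷ 2F ∷ 2F ∷ []) ∷ []) ∷
  ((3F ∷ 3F ∷ []) ∷ (5F ∷ 4F ∷ []) ∷ (0F ∷ 1F ∷ 5F ∷ 2F ∷ 3F ∷ 1F ∷ []) ∷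
   (4F ∷ 4F ∷ 1F ∷ 1F ∷ 2F ∷ 2F ∷ 4F ∷ 3F ∷ 5F ∷ 5F ∷ []) ∷ []) ∷
  ((0F ∷ 1F ∷ []) ∷ (4F ∷ 5F ∷ []) ∷ (3F ∷ 4F ∷ 4F ∷ 2F ∷ 1F ∷ 3F ∷ 3F ∷ []) ∷
   (5F ∷ 5F ∷ 3F ∷ 2F ∷ 2F ∷ 5F ∷ 1F ∷ 1F ∷ 4F ∷ []) ∷ []) ∷
  ((5F ∷ 5F ∷ []) ∷ (0F ∷ 3F ∷ []) ∷ (2F ∷ 4F ∷ 1F ∷ 2F ∷ 3F ∷ 5F ∷ 2F ∷ 2F ∷ []) ∷
   (4F ∷ 3F ∷ 3F ∷ 1F ∷ 1F ∷ 5F ∷ 4F ∷ 4F ∷ []) ∷ []) ∷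
  ((3F ∷ 5F ∷ []) ∷ (1F ∷ 4F ∷ 4F ∷ []) ∷ (4F ∷ 3F ∷ 3F ∷ []) ∷
   (0F ∷ 2F ∷ 2F ∷ 4F ∷ 5F ∷ 5F ∷ 1F ∷ 1F ∷ 3F ∷ 2F ∷ 5F ∷ 0F ∷ []) ∷ []) ∷
  ((3F ∷ 5F ∷ []) ∷ (4F ∷ 4F ∷ 1F ∷ []) ∷ (5F ∷ 5F ∷ 4F ∷ 2F ∷ []) ∷
   (2F ∷ 3F ∷ 3F ∷ 1F ∷ 2F ∷ 2F ∷ 5F ∷ 1F ∷ 1F ∷ 0F ∷ 0F ∷ []) ∷ []) ∷
  ((4F ∷ 3F ∷ []) ∷ (1F ∷ 1F ∷ 2F ∷ []) ∷ (0F ∷ 3F ∷ 3F ∷ 1F ∷ 4F ∷ []) ∷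
   (2F ∷ 5F ∷ 3F ∷ 2F ∷ 2F ∷ 4F ∷ 4F ∷ 5F ∷ 5F ∷ 0F ∷ []) ∷ []) ∷
  ((2F ∷ 5F ∷ []) ∷ (3F ∷ 5F ∷ 1F ∷ []) ∷ (5F ∷ 5F ∷ 4F ∷ 4F ∷ 2F ∷ 3F ∷ []) ∷
   (0F ∷ 1F ∷ 4F ∷ 3F ∷ 3F ∷ 1F ∷ 1F ∷ 2F ∷ 2F ∷ []) ∷ []) ∷
  ((1F ∷ 4F ∷ []) ∷ (4F ∷ 3F ∷ 2F ∷ []) ∷ (3F ∷ 5F ∷ 5F ∷ 2F ∷ 1F ∷ 3F ∷ 3F ∷ []) ∷
   (0F ∷ 2F ∷ 2F ∷ 4F ∷ 4F ∷ 5F ∷ 1F ∷ 1F ∷ []) ∷ []) ∷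
  ((3F ∷ 5F ∷ []) ∷ (0F ∷ 5F ∷ 1F ∷ 1F ∷ []) ∷ (4F ∷ 3F ∷ 1F ∷ 0F ∷ []) ∷
   (2F ∷ 2F ∷ 1F ∷ 4F ∷ 4F ∷ 5F ∷ 5F ∷ 2F ∷ 3F ∷ 3F ∷ []) ∷ []) ∷
  ((4F ∷ 3F ∷ []) ∷ (5F ∷ 4F ∷ 2F ∷ 2F ∷ []) ∷ (1F ∷ 1F ∷ 2F ∷ 0F ∷ 0F ∷ []) ∷
   (3F ∷ 2F ∷ 5F ∷ 5F ∷ 3F ∷ 3F ∷ 1F ∷ 4F ∷ 4F ∷ []) ∷ []) ∷
  ((4F ∷ 2F ∷ []) ∷ (0F ∷ 5F ∷ 1F ∷ 3F ∷ []) ∷ (1F ∷ 4F ∷ 4F ∷ 3F ∷ 3F ∷ 0F ∷ []) ∷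
   (2F ∷ 2F ∷ 5F ∷ 5F ∷ 3F ∷ 2F ∷ 1F ∷ 1F ∷ []) ∷ []) ∷
  ((0F ∷ 1F ∷ []) ∷ (5F ∷ 3F ∷ 4F ∷ 2F ∷ []) ∷ (4F ∷ 1F ∷ 1F ∷ 3F ∷ 3F ∷ 2F ∷ 5F ∷ []) ∷
   (2F ∷ 2F ∷ 1F ∷ 5F ∷ 5F ∷ 4F ∷ 4F ∷ []) ∷ []) ∷
  ((4F ∷ 3F ∷ []) ∷ (3F ∷ 1F ∷ 1F ∷ 5F ∷ 0F ∷ []) ∷ (0F ∷ 2F ∷ 3F ∷ 3F ∷ 5F ∷ []) ∷
   (1F ∷ 2F ∷ 5F ∷ 5F ∷ 4F ∷ 4F ∷ 2F ∷ 2F ∷ []) ∷ []) ∷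
  ((0F ∷ 1F ∷ []) ∷ (2F ∷ 2F ∷ 3F ∷ 1F ∷ 5F ∷ []) ∷ (5F ∷ 2F ∷ 4F ∷ 1F ∷ 1F ∷ 2F ∷ []) ∷
   (3F ∷ 4F ∷ 4F ∷ 5F ∷ 5F ∷ 3F ∷ 3F ∷ []) ∷ []) ∷
  ((0F ∷ 1F ∷ []) ∷ (4F ∷ 3F ∷ 5F ∷ 5F ∷ 2F ∷ 0F ∷ []) ∷ (5F ∷ 4F ∷ 2F ∷ 2F ∷ 1F ∷ 5F ∷ []) ∷
   (3F ∷ 3F ∷ 1F ∷ 1F ∷ 4F ∷ 4F ∷ []) ∷ []) ∷
  ((1F ∷ 2F ∷ 4F ∷ []) ∷ (0F ∷ 5F ∷ 1F ∷ []) ∷ (2F ∷ 2F ∷ 3F ∷ []) ∷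
   (4F ∷ 4F ∷ 1F ∷ 1F ∷ 3F ∷ 5F ∷ 5F ∷ 4F ∷ 3F ∷ 3F ∷ 0F ∷ []) ∷ []) ∷
  ((0F ∷ 3F ∷ 2F ∷ []) ∷ (5F ∷ 3F ∷ 3F ∷ []) ∷ (2F ∷ 2F ∷ 5F ∷ 1F ∷ []) ∷
   (1F ∷ 2F ∷ 4F ∷ 3F ∷ 1F ∷ 1F ∷ 4F ∷ 4F ∷ 5F ∷ 5F ∷ []) ∷ []) ∷
  ((5F ∷ 2F ∷ 3F ∷ []) ∷ (4F ∷ 2F ∷ 0F ∷ []) ∷ (1F ∷ 1F ∷ 3F ∷ 5F ∷ 5F ∷ []) ∷
   (0F ∷ 3F ∷ 3F ∷ 4F ∷ 4F ∷ 5F ∷ 1F ∷ 2F ∷ 2F ∷ []) ∷ []) ∷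
  ((0F ∷ 2F ∷ 1F ∷ []) ∷ (5F ∷ 3F ∷ 0F ∷ []) ∷ (4F ∷ 4F ∷ 3F ∷ 2F ∷ 2F ∷ 5F ∷ []) ∷
   (1F ∷ 4F ∷ 5F ∷ 5F ∷ 1F ∷ 1F ∷ 3F ∷ 3F ∷ []) ∷ []) ∷
  ((5F ∷ 4F ∷ 2F ∷ []) ∷ (1F ∷ 2F ∷ 5F ∷ []) ∷ (0F ∷ 4F ∷ 3F ∷ 3F ∷ 5F ∷ 5F ∷ 1F ∷ []) ∷
   (2F ∷ 2F ∷ 3F ∷ 1F ∷ 1F ∷ 4F ∷ 4F ∷ []) ∷ []) ∷
  ((1F ∷ 1F ∷ 4F ∷ []) ∷ (3F ∷ 4F ∷ 5F ∷ 3F ∷ []) ∷ (2F ∷ 3F ∷ 3F ∷ 1F ∷ []) ∷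
   (4F ∷ 4F ∷ 2F ∷ 2F ∷ 1F ∷ 5F ∷ 5F ∷ 0F ∷ 0F ∷ []) ∷ []) ∷
  ((4F ∷ 5F ∷ 5F ∷ []) ∷ (1F ∷ 3F ∷ 3F ∷ 4F ∷ []) ∷ (2F ∷ 1F ∷ 4F ∷ 4F ∷ 2F ∷ []) ∷
   (0F ∷ 5F ∷ 3F ∷ 2F ∷ 2F ∷ 5F ∷ 1F ∷ 1F ∷ []) ∷ []) ∷
  ((0F ∷ 1F ∷ 5F ∷ []) ∷ (4F ∷ 5F ∷ 5F ∷ 3F ∷ []) ∷ (3F ∷ 3F ∷ 1F ∷ 1F ∷ 2F ∷ 4F ∷ []) ∷
   (5F ∷ 2F ∷ 2F ∷ 3F ∷ 4F ∷ 4F ∷ 1F ∷ []) ∷ []) ∷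
  ((4F ∷ 1F ∷ 3F ∷ []) ∷ (0F ∷ 5F ∷ 4F ∷ 2F ∷ 0F ∷ []) ∷ (3F ∷ 5F ∷ 5F ∷ 2F ∷ 2F ∷ []) ∷
   (1F ∷ 1F ∷ 2F ∷ 3F ∷ 3F ∷ 4F ∷ 4F ∷ []) ∷ []) ∷
  ((0F ∷ 5F ∷ 2F ∷ []) ∷ (2F ∷ 2F ∷ 1F ∷ 3F ∷ 3F ∷ []) ∷ (1F ∷ 4F ∷ 4F ∷ 2F ∷ 3F ∷ 5F ∷ []) ∷
   (3F ∷ 4F ∷ 5F ∷ 5F ∷ 1F ∷ 1F ∷ []) ∷ []) ∷
  ((3F ∷ 5F ∷ 1F ∷ 2F ∷ []) ∷ (1F ∷ 4F ∷ 3F ∷ 3F ∷ []) ∷ (2F ∷ 4F ∷ 4F ∷ 5F ∷ []) ∷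
   (0F ∷ 5F ∷ 5F ∷ 2F ∷ 2F ∷ 3F ∷ 1F ∷ 1F ∷ []) ∷ []) ∷
  ((5F ∷ 1F ∷ 3F ∷ 3F ∷ []) ∷ (0F ∷ 2F ∷ 1F ∷ 1F ∷ []) ∷ (4F ∷ 5F ∷ 5F ∷ 3F ∷ 0F ∷ []) ∷
   (1F ∷ 4F ∷ 2F ∷ 2F ∷ 3F ∷ 4F ∷ 4F ∷ []) ∷ []) ∷
  ((0F ∷ 4F ∷ 3F ∷ 1F ∷ []) ∷ (2F ∷ 4F ∷ 5F ∷ 3F ∷ []) ∷ (5F ∷ 5F ∷ 1F ∷ 1F ∷ 4F ∷ 4F ∷ []) ∷
   (1F ∷ 2F ∷ 2F ∷ 3F ∷ 3F ∷ 0F ∷ []) ∷ []) ∷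
  ((1F ∷ 1F ∷ 4F ∷ 4F ∷ []) ∷ (2F ∷ 2F ∷ 4F ∷ 5F ∷ 5F ∷ []) ∷ (5F ∷ 2F ∷ 1F ∷ 3F ∷ 2F ∷ []) ∷
   (0F ∷ 4F ∷ 3F ∷ 3F ∷ 5F ∷ 1F ∷ []) ∷ []) ∷
  ((1F ∷ 2F ∷ 3F ∷ 5F ∷ 5F ∷ []) ∷ (4F ∷ 1F ∷ 3F ∷ 3F ∷ 0F ∷ []) ∷ (5F ∷ 4F ∷ 4F ∷ 2F ∷ 2F ∷ []) ∷
   (0F ∷ 2F ∷ 5F ∷ 1F ∷ 1F ∷ []) ∷ []) ∷
  []

table₄-disjoint : All EdgeDisjoint table₄
table₄-disjoint = toWitness {a? = All.all? edgeDisjoint? table₄} _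

-- The shortest of four legs with ten edges in total has length 1 or 2, and 2 is the excluded case.
table₄-covers : Covers 1 1 10 table₄
table₄-covers = toWitness {a? = covers? 1 1 10 table₄} _

table₆-disjoint : All EdgeDisjoint table₆
table₆-disjoint = toWitness {a? = All.all? edgeDisjoint? table₆} _

-- The upper bound 20 for the shortest leg is the total size, hence no restriction.
table₆-covers : Covers 2 20 20 table₆
table₆-covers = toWitness {a? = covers? 2 20 20 table₆} _

-- Spiders of maximal size

-- (k² + 4) / 2 for k = 2 t.
maxSize : ℕ → ℕ
maxSize t = 2 * (t * t) + 2

-- Here k = 2 (2 + s), so s = 0 is k = 4, where the last hypothesis excludes a shortest leg of
-- length 2.
Maximal : ℕ → ℕ → ℕ → ℕ → ℕ → Set
Maximal s a b c d = 1 ≤ a → a ≤ b → b ≤ c → c ≤ d → a + b + c + d ≡ maxSize (2 + s) → (s ≡ 0 → a ≡ 1) →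
  Realizable ((2 + s) * 2) (a ∷ b ∷ c ∷ d ∷ [])

-- Shortening two legs destroys the order of the lengths, so they are sorted again; the condition on
-- the shortest leg becomes membership of 1.
sorted⇒all : ∀ {s} → (∀ a b c d → Maximal s a b c d) → ∀ ls → length ls ≡ 4 → All (1 ≤_) ls →
  sumˡ ls ≡ maxSize (2 + s) → (s ≡ 0 → 1 ∈ ls) → Realizable ((2 + s) * 2) ls
sorted⇒all {s} maximal ls len 1≤ls sum≡ 1∈ls = go (sort ls) (sort-↭ ls) (sort-↗ ls) (trans (↭-length (sort-↭ ls)) len)
  where
  regroup : ∀ a b c d → a + b + c + d ≡ a + (b + (c + (d + 0)))
  regroup = solve-∀
  1∈⇒head≡1 : ∀ {a b c d} → 1 ≤ a → a ≤ b → b ≤ c → c ≤ d → 1 ∈ a ∷ b ∷ c ∷ d ∷ [] → a ≡ 1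
  1∈⇒head≡1 1≤a a≤b b≤c c≤d (here refl) = refl
  1∈⇒head≡1 1≤a a≤b b≤c c≤d (there (here refl)) = ≤-antisym a≤b 1≤a
  1∈⇒head≡1 1≤a a≤b b≤c c≤d (there (there (here refl))) = ≤-antisym (≤-trans a≤b b≤c) 1≤a
  1∈⇒head≡1 1≤a a≤b b≤c c≤d (there (there (there (here refl)))) = ≤-antisym (≤-trans a≤b (≤-trans b≤c c≤d)) 1≤a
  go : ∀ ls' → ls' ↭ ls → Sorted ls' → length ls' ≡ 4 → Realizable ((2 + s) * 2) ls
  go (a ∷ b ∷ c ∷ d ∷ []) ls'↭ls (a≤b ∷ b≤c ∷ c≤d ∷ [-]) refl with All-resp-↭ (↭-sym ls'↭ls) 1≤ls
  ... | 1≤a ∷ _ = realizable-↭ ls'↭ls (maximal a b c d 1≤a a≤b b≤c c≤d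
    (trans (regroup a b c d) (trans (sum-↭ ls'↭ls) sum≡))
    λ s≡0 → 1∈⇒head≡1 1≤a a≤b b≤c c≤d (∈-resp-↭ (↭-sym ls'↭ls) (1∈ls s≡0)))

-- The increment is the number of edges added to the 2 t old vertices: 4 t spokes and two loops.
maxSize-suc : ∀ t → maxSize (suc t) ≡ 4 * t + 2 + maxSize t
maxSize-suc = expand
  where
  expand : ∀ t → 2 * ((1 + t) * (1 + t)) + 2 ≡ 4 * t + 2 + (2 * (t * t) + 2)
  expand = solve-∀

-- Undoes `extend` on the legs `x` and `y`. The strict inequalities leave each of them a first edge,
-- and for s = 0 the untouched leg `a` supplies the required 1.
shorten-two : ∀ {s} → (∀ a b c d → Maximal s a b c d) → ∀ {a b x y} p q → p + suc q ≡ 2 + s →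
  1 ≤ a → 1 ≤ b → 4 * p < x → 4 * suc q + 2 < y → a + b + x + y ≡ maxSize (3 + s) → (s ≡ 0 → a ≡ 1) →
  Realizable ((3 + s) * 2) (x ∷ y ∷ a ∷ b ∷ [])
shorten-two {s} maximal {a} {b} {x} {y} p q p+1+q≡2+s 1≤a 1≤b 4p<x 4q<y sum≡ a≡1
  with m≤n⇒∃[o]m+o≡n 4p<x | m≤n⇒∃[o]m+o≡n 4q<y
... | x' , refl | y' , refl = subst₂ (λ x y → Realizable ((3 + s) * 2) (x ∷ y ∷ a ∷ b ∷ []))
  (+-suc (4 * p) x') (+-suc (4 * suc q + 2) y')
  (extend p q p+1+q≡2+s (sorted⇒all maximal (suc x' ∷ suc y' ∷ a ∷ b ∷ []) refl
    (s≤s z≤n ∷ s≤s z≤n ∷ 1≤a ∷ 1≤b ∷ [])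
    (+-cancelˡ-≡ (4 * (2 + s) + 2) _ _ (begin
      4 * (2 + s) + 2 + (suc x' + (suc y' + (a + (b + 0))))
        ≡⟨ cong (λ t → 4 * t + 2 + (suc x' + (suc y' + (a + (b + 0))))) p+1+q≡2+s ⟨
      4 * (p + suc q) + 2 + (suc x' + (suc y' + (a + (b + 0))))
        ≡⟨ regroup p (suc q) x' y' a b ⟩
      a + b + (suc (4 * p) + x') + (suc (4 * suc q + 2) + y')
        ≡⟨ sum≡ ⟩
      maxSize (3 + s)
        ≡⟨ maxSize-suc (2 + s) ⟩
      4 * (2 + s) + 2 + maxSize (2 + s) ∎))
    λ s≡0 → there (there (here (sym (a≡1 s≡0))))))
  where
  open ≡-Reasoning
  regroup : ∀ p q x y a b → 4 * (p + q) + 2 + (1 + x + (1 + y + (a + (b + 0)))) ≡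
    a + b + (1 + (4 * p) + x) + (1 + (4 * q + 2) + y)
  regroup = solve-∀

↭-rotate : ∀ (a b c d : ℕ) → c ∷ d ∷ a ∷ b ∷ [] ↭ a ∷ b ∷ c ∷ d ∷ []
↭-rotate a b c d = ++-comm (c ∷ d ∷ []) (a ∷ b ∷ [])

-- For k = 6 with a = 1: the other legs add up to 19, d is at most 10, and the closed trails to be
-- removed have lengths 4 and 6.
K₆-lengths : ∀ {c} → c < 11 → ∀ {d} → d < 11 → 19 ≤ 2 * c + d → c ≤ d → 4 < c × 6 < d
K₆-lengths = toWitness {a? = allUpTo? (λ c → allUpTo? (λ d →
  19 ≤? 2 * c + d →-dec (c ≤? d →-dec (4 <? c ×-dec 6 <? d))) 11) 11} _

-- For k = 8: the legs add up to 34, d is at most 14, and the closed trails to be removed have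
-- lengths 6 and 8.
K₈-lengths : ∀ {c} → c < 15 → ∀ {d} → d < 15 → 34 ≤ 3 * c + d → c ≤ d → 6 < c × 8 < d
K₈-lengths = toWitness {a? = allUpTo? (λ c → allUpTo? (λ d →
  34 ≤? 3 * c + d →-dec (c ≤? d →-dec (6 <? c ×-dec 8 <? d))) 15) 15} _

-- q + 1 is the quotient of d - 3 by 4.
long-lengths : ∀ r {a b c d} → a ≤ b → b ≤ c → c ≤ d → a + b + c + d ≡ maxSize (5 + r) → d ≤ 4 * (4 + r) + 2 →
  ∃₂ λ p q → p + suc q ≡ 4 + r × 4 * p < c × 4 * suc q + 2 < d
-- This is the largest q with 4 (q + 1) + 2 < d; it makes p, and with it the demand on `c`, as small
-- as possible.
long-lengths r {a} {b} {c} {d} a≤b b≤c c≤d sum≡ d≤ = split ((d ∸ 3) / 4) ((d ∸ 3) % 4) (m%n<n (d ∸ 3) 4)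
  (trans (sym (m+[n∸m]≡n 3≤d)) (cong (3 +_) (m≡m%n+[m/n]*n (d ∸ 3) 4)))
  where
  open ≤-Reasoning
  2[c+d]≥ : maxSize (5 + r) ≤ 2 * (c + d)
  2[c+d]≥ = begin
    maxSize (5 + r)  ≡⟨ sum≡ ⟨
    a + b + c + d    ≤⟨ +-monoˡ-≤ d (+-monoˡ-≤ c (+-mono-≤ (≤-trans a≤b b≤c) (≤-trans b≤c c≤d))) ⟩
    c + d + c + d    ≡⟨ regroup c d ⟩
    2 * (c + d)      ∎
    where
    regroup : ∀ c d → c + d + c + d ≡ 2 * (c + d)
    regroup = solve-∀
  expand : maxSize (5 + r) ≡ 52 + (20 * r + 2 * (r * r))
  expand = expand′ r
    where
    expand′ : ∀ r → 2 * ((5 + r) * (5 + r)) + 2 ≡ 52 + (20 * r + 2 * (r * r))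
    expand′ = solve-∀
  -- Rules out the quotient 0, for which `d` would be at most 6.
  13≤d : 13 ≤ d
  13≤d = *-cancelˡ-≤ 4 (begin
    52                     ≤⟨ m≤m+n 52 _ ⟩
    52 + (20 * r + 2 * (r * r)) ≡⟨ expand ⟨
    maxSize (5 + r)        ≤⟨ 2[c+d]≥ ⟩
    2 * (c + d)            ≤⟨ *-monoʳ-≤ 2 (+-monoˡ-≤ d c≤d) ⟩
    2 * (d + d)            ≡⟨ regroup d ⟩
    4 * d                  ∎)
    where
    regroup : ∀ d → 2 * (d + d) ≡ 4 * d
    regroup = solve-∀
  3≤d : 3 ≤ d
  3≤d = ≤-trans (m≤m+n 3 10) 13≤d
  split : ∀ q' ρ → ρ < 4 → d ≡ 3 + (ρ + q' * 4) → ∃₂ λ p q → p + suc q ≡ 4 + r × 4 * p < c × 4 * suc q + 2 < d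
  split zero ρ ρ<4 d≡ = contradiction (begin-strict
    6                  <⟨ m≤m+n 7 6 ⟩
    13                 ≤⟨ 13≤d ⟩
    d                  ≡⟨ d≡ ⟩
    3 + (ρ + 0)        ≡⟨ cong (3 +_) (+-identityʳ ρ) ⟩
    3 + ρ              ≤⟨ +-monoʳ-≤ 3 (s≤s⁻¹ ρ<4) ⟩
    6                  ∎) (<-irrefl refl)
  split (suc q) ρ ρ<4 d≡ with m≤n⇒∃[o]m+o≡n 1+q≤4+r
    where
    1+q≤4+r : suc q ≤ 4 + r
    1+q≤4+r = *-cancelˡ-≤ 4 (+-cancelʳ-≤ 2 _ _ (begin
      4 * suc q + 2             ≤⟨ m≤n+m _ (1 + ρ) ⟩
      1 + ρ + (4 * suc q + 2)   ≡⟨ regroup ρ (suc q) ⟩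
      3 + (ρ + suc q * 4)       ≡⟨ d≡ ⟨
      d                         ≤⟨ d≤ ⟩
      4 * (4 + r) + 2           ∎))
      where
      regroup : ∀ ρ q → 1 + ρ + (4 * q + 2) ≡ 3 + (ρ + q * 4)
      regroup = solve-∀
  ... | p , 1+q+p≡4+r = p , q , trans (+-comm p (suc q)) 1+q+p≡4+r , ≰⇒> c≰4p , (begin-strict
    4 * suc q + 2             <⟨ m<n+m _ (s≤s z≤n) ⟩
    suc ρ + (4 * suc q + 2)     ≡⟨ regroup₁ ρ (suc q) ⟩
    3 + (ρ + suc q * 4)       ≡⟨ d≡ ⟨
    d                         ∎)
    where
    regroup₁ : ∀ ρ q → 1 + ρ + (4 * q + 2) ≡ 3 + (ρ + q * 4)
    regroup₁ = solve-∀
    regroup₂ : ∀ p q ρ → 4 * p + (3 + (ρ + q * 4)) ≡ 4 * (q + p) + 3 + ρ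
    regroup₂ = solve-∀
    regroup₃ : ∀ r → 2 * (4 * (4 + r) + 3 + 3) + 1 + (12 * r + (7 + 2 * (r * r))) ≡ 52 + (20 * r + 2 * (r * r))
    regroup₃ = solve-∀
    c≰4p : ¬ (c ≤ 4 * p)
    -- Otherwise 2 (c + d) would be at most 44 + 8 r, less than the quadratic lower bound 52 + 20 r
    -- + 2 r². For k = 8 the same estimate gives 36 against 34, so that case is separate.
    c≰4p c≤4p = contradiction (begin-strict
      2 * (c + d)
        ≤⟨ *-monoʳ-≤ 2 (+-mono-≤ c≤4p (≤-reflexive d≡)) ⟩
      2 * (4 * p + (3 + (ρ + suc q * 4)))
        ≡⟨ cong (2 *_) (regroup₂ p (suc q) ρ) ⟩
      2 * (4 * (suc q + p) + 3 + ρ)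
        ≤⟨ *-monoʳ-≤ 2 (+-monoʳ-≤ (4 * (suc q + p) + 3) (s≤s⁻¹ ρ<4)) ⟩
      2 * (4 * (suc q + p) + 3 + 3)
        ≡⟨ cong (λ m → 2 * (4 * m + 3 + 3)) 1+q+p≡4+r ⟩
      2 * (4 * (4 + r) + 3 + 3)
        <⟨ m<m+n _ (s≤s z≤n) ⟩
      2 * (4 * (4 + r) + 3 + 3) + 1
        ≤⟨ m≤m+n _ _ ⟩
      2 * (4 * (4 + r) + 3 + 3) + 1 + (12 * r + (7 + 2 * (r * r)))
        ≡⟨ regroup₃ r ⟩
      52 + (20 * r + 2 * (r * r))
        ≡⟨ expand ⟨
      maxSize (5 + r)
        ≤⟨ 2[c+d]≥ ⟩
      2 * (c + d) ∎) (<-irrefl refl)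

grow : ∀ s → (∀ a b c d → Maximal s a b c d) → ∀ {a b c d} → 1 ≤ a → a ≤ b → b ≤ c → c ≤ d →
  a + b + c + d ≡ maxSize (3 + s) → (s ≡ 0 → a ≡ 1) → Realizable ((3 + s) * 2) (a ∷ b ∷ c ∷ d ∷ [])
grow s IH {a} {b} {c} {d} 1≤a a≤b b≤c c≤d sum≡ a≡1 with d ≤? 4 * (2 + s) + 2
-- The longest leg alone can give up all new edges, so p = 0.
... | no d≰ = realizable-↭ (↭-rotate a b c d)
  (shorten-two IH 0 (suc s) refl 1≤a 1≤b (≤-trans 1≤b b≤c) (≰⇒> d≰) sum≡ a≡1)
  where 1≤b = ≤-trans 1≤a a≤b
grow 0 IH {a} {b} {c} {d} 1≤a a≤b b≤c c≤d sum≡ a≡1 | yes d≤ with a≡1 refl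
... | refl =
  let 4<c , 6<d = K₆-lengths (s≤s (≤-trans c≤d d≤)) (s≤s d≤)
        (subst₂ (λ l r → l ≤ r + d) (suc-injective sum≡) (cong (c +_) (sym (+-identityʳ c)))
          (+-monoˡ-≤ d (+-monoˡ-≤ c b≤c)))
        c≤d
  in realizable-↭ (↭-rotate a b c d) (shorten-two IH 1 0 refl 1≤a (≤-trans 1≤a a≤b) 4<c 6<d sum≡ a≡1)
-- Here the longest leg gives up the closed trail of length 8 and `c` the one with the loops. For
-- lengths 8, 8, 8, 10 this is the only possibility on the two longest legs.
grow 1 IH {a} {b} {c} {d} 1≤a a≤b b≤c c≤d sum≡ a≡1 | yes d≤ =
  let 6<c , 8<d = K₈-lengths (s≤s (≤-trans c≤d d≤)) (s≤s d≤) 34≤3c+d c≤d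
  in realizable-↭ (↭-trans (swap d c ↭-refl) (↭-rotate a b c d))
       (shorten-two IH 2 0 refl 1≤a (≤-trans 1≤a a≤b) 8<d 6<c (trans (exchange a b c d) sum≡) a≡1)
  where
  open ≤-Reasoning
  exchange : ∀ a b c d → a + b + d + c ≡ a + b + c + d
  exchange = solve-∀
  collect : ∀ c d → c + c + c + d ≡ 3 * c + d
  collect = solve-∀
  34≤3c+d : 34 ≤ 3 * c + d
  34≤3c+d = begin
    34              ≡⟨ sum≡ ⟨
    a + b + c + d   ≤⟨ +-monoˡ-≤ d (+-monoˡ-≤ c (+-mono-≤ (≤-trans a≤b b≤c) b≤c)) ⟩
    c + c + c + d   ≡⟨ collect c d ⟩
    3 * c + d       ∎
grow (suc (suc r)) IH {a} {b} {c} {d} 1≤a a≤b b≤c c≤d sum≡ a≡1 | yes d≤ =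
  let p , q , p+1+q≡ , 4p<c , 4q<d = long-lengths r a≤b b≤c c≤d sum≡ d≤
  in realizable-↭ (↭-rotate a b c d) (shorten-two IH p q p+1+q≡ 1≤a (≤-trans 1≤a a≤b) 4p<c 4q<d sum≡ a≡1)

maximal-K₄ : ∀ a b c d → Maximal 0 a b c d
maximal-K₄ a b c d 1≤a a≤b b≤c c≤d sum≡ a≡1 =
  table⇒realizable table₄-disjoint table₄-covers 1≤a (≤-reflexive (a≡1 refl)) a≤b b≤c c≤d sum≡

maximal : ∀ s a b c d → Maximal s a b c d
maximal 0 = maximal-K₄
maximal 1 a b c d 1≤a a≤b b≤c c≤d sum≡ _ with a ≟ 1
-- The step down to K₄* leaves the shortest leg untouched and therefore needs it to have length 1.
... | yes a≡1 = grow 0 maximal-K₄ 1≤a a≤b b≤c c≤d sum≡ λ _ → a≡1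
... | no  a≢1 = table⇒realizable table₆-disjoint table₆-covers (≤∧≢⇒< 1≤a (a≢1 ∘ sym)) a≤20 a≤b b≤c c≤d sum≡
  where
  a≤20 : a ≤ 20
  a≤20 = ≤-trans (≤-trans (m≤m+n a b) (≤-trans (m≤m+n (a + b) c) (m≤m+n (a + b + c) d))) (≤-reflexive sum≡)
maximal (suc (suc s)) a b c d 1≤a a≤b b≤c c≤d sum≡ _ =
  grow (suc s) (maximal (suc s)) 1≤a a≤b b≤c c≤d sum≡ λ ()

-- Spiders of arbitrary size and the equivalence

embeds : ∀ s (ℓ : Fin 4 → ℕ) → 1 ≤ ℓ 0F → ℓ 0F ≤ ℓ 1F → ℓ 1F ≤ ℓ 2F → ℓ 2F ≤ ℓ 3F →
  ℓ 0F + ℓ 1F + ℓ 2F + ℓ 3F ≤ maxSize (2 + s) → ¬ (s ≡ 0 × ℓ 0F ≡ 2) →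
  EmbedsIn (Spider ℓ) ((2 + s) * 2)
-- The missing edges `o` are added to the longest leg, which keeps the lengths sorted, and are cut
-- off again by `realizable⇒embeds`.
embeds s ℓ 1≤a a≤b b≤c c≤d n≤ not-K₄-2 with m≤n⇒∃[o]m+o≡n n≤
... | o , n+o≡ = realizable⇒embeds
  (maximal s (ℓ 0F) (ℓ 1F) (ℓ 2F) (ℓ 3F + o) 1≤a a≤b b≤c (≤-trans c≤d (m≤m+n _ o))
    (trans (sym (+-assoc (ℓ 0F + ℓ 1F + ℓ 2F) (ℓ 3F) o)) n+o≡) a≡1)
  ℓ ≤-refl ≤-refl ≤-refl (m≤m+n _ o)
  where
  open ≤-Reasoning
  4*a : ∀ a → a * 4 ≡ a + a + a + a
  4*a = solve-∀
  a≡1 : s ≡ 0 → ℓ 0F ≡ 1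
  -- For k = 4 the sum is at most 10 < 12, so the shortest leg is at most 2, and 2 is excluded.
  a≡1 refl = ≤-antisym (s≤s⁻¹ (≤∧≢⇒< (s≤s⁻¹ (*-cancelʳ-< 4 (ℓ 0F) 3 (begin-strict
    ℓ 0F * 4                         ≡⟨ 4*a (ℓ 0F) ⟩
    ℓ 0F + ℓ 0F + ℓ 0F + ℓ 0F         ≤⟨ +-mono-≤ (+-mono-≤ (+-monoʳ-≤ (ℓ 0F) a≤b) (≤-trans a≤b b≤c))
                                             (≤-trans a≤b (≤-trans b≤c c≤d)) ⟩
    ℓ 0F + ℓ 1F + ℓ 2F + ℓ 3F         ≤⟨ n≤ ⟩
    10                               <⟨ s≤s (m≤m+n 10 1) ⟩
    12 ∎))) (λ a≡2 → not-K₄-2 (refl , a≡2)))) 1≤a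

even-embeds : ∀ {k} → 2 ∣ k → (ℓ : Fin 4 → ℕ) → 1 ≤ ℓ 0F → ℓ 0F ≤ ℓ 1F → ℓ 1F ≤ ℓ 2F → ℓ 2F ≤ ℓ 3F →
  4 ≤ k → 2 * (ℓ 0F + ℓ 1F + ℓ 2F + ℓ 3F) ≤ k * k + 4 → ¬ (k ≡ 4 × ℓ 0F ≡ 2) → EmbedsIn (Spider ℓ) k
even-embeds (divides t refl) ℓ 1≤a a≤b b≤c c≤d 4≤k 2n≤ not-K₄-2 with m≤n⇒∃[o]m+o≡n (*-cancelʳ-≤ 2 t 2 4≤k)
... | s , refl = embeds s ℓ 1≤a a≤b b≤c c≤d
  (*-cancelˡ-≤ 2 (≤-trans 2n≤ (≤-reflexive (double-maxSize (2 + s)))))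
  λ (s≡0 , a≡2) → not-K₄-2 (cong (λ s → (2 + s) * 2) s≡0 , a≡2)
  where
  double-maxSize : ∀ t → t * 2 * (t * 2) + 4 ≡ 2 * (2 * (t * t) + 2)
  double-maxSize = solve-∀

theorem3p3 : (k : ℕ) → 1 ≤ k → 2 ∣ k →
    (ℓ : Fin 4 → ℕ) →
    1 ≤ ℓ zero → ℓ zero ≤ ℓ (suc zero) →
    ℓ (suc zero) ≤ ℓ (suc (suc zero)) → ℓ (suc (suc zero)) ≤ ℓ (suc (suc (suc zero))) →
    EmbedsIn (Spider ℓ) k ⇔
    (k ≥ 4 ×
    2 * (ℓ zero + ℓ (suc zero) + ℓ (suc (suc zero)) + ℓ (suc (suc (suc zero)))) ≤ k * k + 4 ×
    ¬ ((k ≡ 4) × (ℓ zero ≡ 2)))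
theorem3p3 k _ 2∣k ℓ 1≤ℓ₀ ℓ₀≤ℓ₁ ℓ₁≤ℓ₂ ℓ₂≤ℓ₃ = mk⇔ necessary
  λ (4≤k , 2n≤ , not-K₄-2) → even-embeds 2∣k ℓ 1≤ℓ₀ ℓ₀≤ℓ₁ ℓ₁≤ℓ₂ ℓ₂≤ℓ₃ 4≤k 2n≤ not-K₄-2
  where
  ℓ₀≤ : ∀ i → ℓ 0F ≤ ℓ i
  ℓ₀≤ 0F = ≤-refl
  ℓ₀≤ 1F = ℓ₀≤ℓ₁
  ℓ₀≤ 2F = ≤-trans ℓ₀≤ℓ₁ ℓ₁≤ℓ₂
  ℓ₀≤ 3F = ≤-trans ℓ₀≤ℓ₁ (≤-trans ℓ₁≤ℓ₂ ℓ₂≤ℓ₃)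

  1≤ℓ : ∀ i → 1 ≤ ℓ i
  1≤ℓ i = ≤-trans 1≤ℓ₀ (ℓ₀≤ i)

  n = ℓ 0F + ℓ 1F + ℓ 2F + ℓ 3F

  necessary : EmbedsIn (Spider ℓ) k → k ≥ 4 × 2 * n ≤ k * k + 4 × ¬ (k ≡ 4 × ℓ 0F ≡ 2)
  -- If the shortest leg has length 2, every leg has a second edge, against `unit-leg-in-K₄`.
  necessary emb = 4≤order 1≤ℓ emb , size-bound 1≤ℓ emb 2∣k , λ (k≡4 , ℓ₀≡2) →
    let i , ℓᵢ≱2 = unit-leg-in-K₄ 1≤ℓ emb k≡4 in ℓᵢ≱2 (subst (_≤ ℓ i) ℓ₀≡2 (ℓ₀≤ i))
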